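{- Let $q=2^r$. (a) If either $n\ge3$ is odd (and $q$ arbitrary) or $n=1$ and $q\ge8$, then the map $\mathbb{F}_q\to C(DC^-(n,q))^\perp$, $a\mapsto c^-(a)$, is an $\mathbb{F}_2$-linear isomorphism. (b) If either $n\ge4$ is even (and $q$ arbitrary) or $n=2$ and $q\ge4$, then the map $\mathbb{F}_q\to C(DC^+(n,q))^\perp$, $a\mapsto c^+(a)$, is an $\mathbb{F}_2$-linear isomorphism.
   Context: $q=2^r$; $tr:\mathbb{F}_q\to\mathbb{F}_2$, $tr(x)=x+x^2+\dots+x^{2^{r-1}}$; $\mathrm{Tr}$ is the matrix trace. $Sp(2n,q)=\{w\in GL(2n,\mathbb{F}_q):{}^twJw=J\}$, $J=\begin{pmatrix}0&1_n\\1_n&0\end{pmatrix}$. $P=P(2n,q)$ is the subgroup of all $\begin{pmatrix}A&0\\0&{}^tA^{ -1}\end{pmatrix}\begin{pmatrix}1_n&B\\0&1_n\end{pmatrix}$, $A\in GL(n,\mathbb{F}_q)$, $B$ symmetric. $\sigma_s=\begin{pmatrix}0&0&1_s&0\\0&1_{n-s}&0&0\\1_s&0&0&0\\0&0&0&1_{n-s}\end{pmatrix}$ (block sizes $s,n-s,s,n-s$). $DC^-(n,q)=P\sigma_{n-1}P$ ($n$ odd), $DC^+(n,q)=P\sigma_{n-2}P$ ($n$ even). For $D=DC^\mp(n,q)$ with $N=|D|$, fix an ordering $g_1,\dots,g_N$ of $D$ and let $C(D)=\{u\in\mathbb{F}_2^N:\sum_j u_j\,\mathrm{Tr}\,g_j=0\text{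 in }\mathbb{F}_q\}$; $C(D)^\perp$ is its dual with respect to the standard inner product on $\mathbb{F}_2^N$, and $C(D)^\perp=\{c^\mp(a):a\in\mathbb{F}_q\}$ where $c^\mp(a)=(tr(a\,\mathrm{Tr}\,g_1),\dots,tr(a\,\mathrm{Tr}\,g_N))$. -}

module Defs where

open import Level using (0ℓ)
open import Data.Bool using (Bool; true; false; _xor_; _∧_; if_then_else_)
open import Data.Nat as ℕ using (ℕ; zero; suc; _<_; _≤_)
open import Data.Fin as Fin using (Fin; splitAt; _↑ˡ_; _↑ʳ_; toℕ)
open import Data.Sum using (_⊎_; inj₁; inj₂)
open import Data.Product using (Σ; ∃; _×_; _,_)
open import Relation.Nullary using (¬_; Dec; does)
open import Relation.Binary.PropositionalEquality using (_≡_)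
open import Algebra.Bundles using (CommutativeRing)
open import Function using (_⇔_)

-- A finite field of order q = 2^r (given abstractly; such a field is
-- unique up to isomorphism).  Equality is the setoid equality _≈_.

record FiniteField (r : ℕ) : Set₁ where
  field
    cring     : CommutativeRing 0ℓ 0ℓ
  open CommutativeRing cring public
  field
    _≟_       : (x y : Carrier) → Dec (x ≈ y)
    0≉1       : ¬ (0# ≈ 1#)
    inverse   : (x : Carrier) → ¬ (x ≈ 0#) → Σ Carrier (λ y → (x * y) ≈ 1#)
    enum      : Fin (2 ℕ.^ r) → Carrier
    enum-inj  : ∀ i j → enum i ≈ enum j → i ≡ j
    enum-surj : ∀ x → Σ (Fin (2 ℕ.^ r)) (λ i → enum i ≈ x)

module _ {r : ℕ} (F : FiniteField r) where
  open FiniteField F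

  Σ[<_]_ : (m : ℕ) → (Fin m → Carrier) → Carrier
  Σ[< zero ] f = 0#
  Σ[< suc m ] f = f Fin.zero + Σ[< m ] (λ i → f (Fin.suc i))

  pow : Carrier → ℕ → Carrier
  pow x zero = 1#
  pow x (suc k) = x * pow x k

  -- absolute trace tr : F_q → F_2, tr(x) = x + x^2 + ... + x^(2^(r-1)),
  -- computed in F_q ...
  trF : Carrier → Carrier
  trF x = Σ[< r ] (λ i → pow x (2 ℕ.^ toℕ i))

  -- ... and read as an element of F_2 = Bool (true ↔ 1)
  tr : Carrier → Bool
  tr x = does (trF x ≟ 1#)

  Mat : ℕ → Set
  Mat m = Fin m → Fin m → Carrier

  _≈M_ : {m : ℕ} → Mat m → Mat m → Set
  M ≈M N = ∀ i j → M i j ≈ N i j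

  _*M_ : {m : ℕ} → Mat m → Mat m → Mat m
  _*M_ {m} M N i j = Σ[< m ] (λ k → M i k * N k j)

  idM : {m : ℕ} → Mat m
  idM i j = if does (i Fin.≟ j) then 1# else 0#

  transpose : {m : ℕ} → Mat m → Mat m
  transpose M i j = M j i

  MTr : {m : ℕ} → Mat m → Carrier
  MTr {m} M = Σ[< m ] (λ i → M i i)

  block : {n : ℕ} → Mat n → Mat n → Mat n → Mat n → Mat (n ℕ.+ n)
  block {n} A B C D i j with splitAt n i | splitAt n j
  ... | inj₁ a | inj₁ b = A a b
  ... | inj₁ a | inj₂ b = B a b
  ... | inj₂ a | inj₁ b = C a b
  ... | inj₂ a | inj₂ b = D a b

  zeroM : {m : ℕ} → Mat m
  zeroM i j = 0#

  InP : {n : ℕ} → Mat (n ℕ.+ n) → Set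
  InP {n} g = ∃ λ (A : Mat n) → ∃ λ (Ainv : Mat n) → ∃ λ (B : Mat n) →
      ((A *M Ainv) ≈M idM) × ((Ainv *M A) ≈M idM) × (transpose B ≈M B) ×
      (g ≈M (block {n} A zeroM zeroM (transpose Ainv) *M block {n} idM B zeroM idM))

  -- σ_s: with blocks of sizes s, n-s, s, n-s.  Writing an index of
  -- Fin (n + n) as (top/bottom, k) with k : Fin n, σ_s swaps top/bottom
  -- for k < s and fixes the index for k ≥ s.
  σ : (n s : ℕ) → Mat (n ℕ.+ n)
  σ n s = block {n} (λ a b → diagSel a b true) (λ a b → diagSel a b false)
                (λ a b → diagSel a b false) (λ a b → diagSel a b true)
    where
    diagSel : Fin n → Fin n → Bool → Carrier
    diagSel a b sameSide =
      if does (a Fin.≟ b)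
      then (if does (toℕ a ℕ.<? s) then (if sameSide then 0# else 1#)
                                   else (if sameSide then 1# else 0#))
      else 0#

  InDC : (n s : ℕ) → Mat (n ℕ.+ n) → Set
  InDC n s g = ∃ λ p₁ → ∃ λ p₂ → InP {n} p₁ × InP {n} p₂ × (g ≈M ((p₁ *M σ n s) *M p₂))

  record Enumeration {m : ℕ} (D : Mat m → Set) (N : ℕ) : Set where
    field
      g     : Fin N → Mat m
      g∈D   : ∀ j → D (g j)
      g-inj : ∀ i j → g i ≈M g j → i ≡ j
      g-sur : ∀ M → D M → Σ (Fin N) (λ j → g j ≈M M)

  module _ {m : ℕ} {D : Mat m → Set} {N : ℕ} (E : Enumeration D N) where
    open Enumeration E

    InC : (Fin N → Bool) → Set
    InC u = Σ[< N ] (λ j → if u j then MTr (g j) else 0#) ≈ 0#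

    dot : (Fin N → Bool) → (Fin N → Bool) → Bool
    dot u v = foldXor N (λ j → u j ∧ v j)
      where
      foldXor : (k : ℕ) → (Fin k → Bool) → Bool
      foldXor zero f = false
      foldXor (suc k) f = f Fin.zero xor foldXor k (λ i → f (Fin.suc i))

    InC⊥ : (Fin N → Bool) → Set
    InC⊥ v = ∀ u → InC u → dot u v ≡ false

    cw : Carrier → (Fin N → Bool)
    cw a j = tr (a * MTr (g j))

    IsF2Iso : Set
    IsF2Iso =
      (∀ a → InC⊥ (cw a)) ×
      (∀ a b j → cw (a + b) j ≡ (cw a j xor cw b j)) ×
      (∀ a b → (∀ j → cw a j ≡ cw b j) → a ≈ b) ×
      (∀ v → InC⊥ v → Σ Carrier (λ a → ∀ j → v j ≡ cw a j))

{-# OPTIONS --safe #-}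
module Submission where

-- Let T be the trace form of F_q and t_j = Tr g_j.  Since T is nondegenerate, C(D) is the orthogonal of
-- the space W of the words c(a), so C(D)⊥ = W⊥⊥ = W by the Fredholm alternative over F_2.  Injectivity
-- says that T(a t_j) = 0 for all j forces a = 0.  This is nondegeneracy of T once the t_j exhaust F_q:
-- for s ≥ 1 because of the elements (1 B; 0 1) σ_s, and for n = 2, q ≥ 4 because Tr A + Tr A⁻¹ is
-- already arbitrary.  For n = 1 the t_j are the x + x⁻¹, and the Weil bound for Kloosterman sums is
-- avoided: x^(q/2) T(a(x + x⁻¹)) agrees for x ≠ 0 with a polynomial of degree < q − 1 and constant
-- term a^(q/2); if it vanishes at all q − 1 points x ≠ 0, it is zero.

open import Defs
open import Level using (0ℓ)
open import Algebra.Bundles using (CommutativeMonoid; CommutativeRing)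
import Algebra.Properties.CommutativeMonoid.Sum
open import Data.Bool as Bool using (Bool; true; false; _xor_; _∧_; if_then_else_)
open import Data.Bool.Properties as Boolₚ
  using (xor-∧-commutativeRing; xor-same; xor-assoc; xor-identityʳ; ∧-distribˡ-xor; ∧-distribʳ-xor)
open import Data.Empty using (⊥; ⊥-elim)
open import Data.Fin as Fin using (Fin; toℕ; splitAt; _↑ˡ_; _↑ʳ_)
import Data.Fin.Properties as Finₚ
open import Data.Fin.Permutation using (permutation)
open import Data.List using (List; []; _∷_; tabulate)
open import Data.List.Relation.Unary.All as All using (All; []; _∷_)
open import Data.List.Relation.Unary.All.Properties using (tabulate⁻)
open import Data.Nat as ℕ using (ℕ; zero; suc; _≤_; _<_; _∸_; z≤n; s≤s)
import Data.Nat.Properties as ℕₚ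
open import Data.Product using (Σ; ∃; _×_; _,_; proj₁; proj₂)
open import Data.Sum using (_⊎_; inj₁; inj₂)
open import Function using (_∘_; id; case_of_)
open import Relation.Binary.PropositionalEquality as ≡ using (_≡_; _≢_)
open import Relation.Nullary using (¬_; yes; no; does; contradiction)

-- The bounds on q are where the small cases really change. For n = 1 and q = 4 the values x + x⁻¹
-- are only 0 and 1, and tr(1) = 0 makes c(1) the zero word; in the polynomial this shows as the
-- exponent q/2 + q/4 = q - 1, one too large for q - 1 roots. For n = 2, Tr A⁻¹ = Tr A / det A, so
-- Tr A + Tr A⁻¹ = Tr A (1 + 1/det A): this is arbitrary once some determinant differs from 1, and
-- always 0 for q = 2. The field is known only through an enumeration of its q elements.
-- Characteristic 2 and x^q = x are therefore derived, by comparing the sum or product of all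
-- elements before and after a permutation. Polynomials enter only as functions, and each argument
-- reads off a single value, the one at 0.

module _ (M : CommutativeMonoid 0ℓ 0ℓ) where
  open CommutativeMonoid M
  open import Algebra.Properties.CommutativeMonoid.Sum M

  sum-single : ∀ {n} (f : Fin n → Carrier) i → (∀ j → j ≢ i → f j ≈ ε) → sum f ≈ f i
  sum-single {suc n} f i others = trans (sum-remove {i = i} f)
    (trans (∙-congˡ (trans (sum-cong-≋ (λ j → others _ (Finₚ.punchInᵢ≢i i j))) (sum-replicate-zero n)))
           (identityʳ _))

  sum-↑ : ∀ m {n} (f : Fin (m ℕ.+ n) → Carrier) →
          sum f ≈ sum (λ i → f (i ↑ˡ n)) ∙ sum (λ j → f (m ↑ʳ j))
  sum-↑ zero    f = sym (identityˡ _)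
  sum-↑ (suc m) f = trans (∙-congˡ (sum-↑ m (f ∘ Fin.suc))) (sym (assoc _ _ _))

  -- Both sides combine h 0, ..., h n. This subtraction-free form compares the sum of the conjugates
  -- of an element with its shift by Frobenius.
  sum-telescope : ∀ n (h : ℕ → Carrier) →
    h 0 ∙ sum {n} (λ i → h (suc (toℕ i))) ≈ sum {n} (λ i → h (toℕ i)) ∙ h n
  sum-telescope zero    h = comm _ _
  sum-telescope (suc n) h =
    trans (∙-congˡ (sum-telescope n (h ∘ suc))) (sym (assoc _ _ _))

-- Characteristic 2, Frobenius and x^q = x

module FieldTheory {m : ℕ} (F : FiniteField (suc m)) where
  open FiniteField F
  open import Algebra.Properties.Semiring.Sum semiring
  open import Algebra.Properties.Semiring.Exp semiring
  open import Algebra.Properties.Semiring.Mult semiring using (×1-homo-*) renaming (_×_ to _·_)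
  open import Algebra.Properties.Group +-group using (identityʳ-unique)
  open import Algebra.Solver.Ring.NaturalCoefficients.Default commutativeSemiring
    using (solve; _:=_; _:+_; _:*_; con)
  open import Relation.Binary.Reasoning.Setoid setoid
  import Algebra.Properties.CommutativeMonoid.Sum *-commutativeMonoid as ∏

  q : ℕ
  q = 2 ℕ.^ suc m

  _⁻¹[_] : ∀ x → ¬ x ≈ 0# → Carrier
  x ⁻¹[ x≉0 ] = proj₁ (inverse x x≉0)

  *-inverseʳ : ∀ x x≉0 → x * x ⁻¹[ x≉0 ] ≈ 1#
  *-inverseʳ x x≉0 = proj₂ (inverse x x≉0)

  *-cancelˡ-0 : ∀ x {y} → ¬ x ≈ 0# → x * y ≈ 0# → y ≈ 0#
  *-cancelˡ-0 x {y} x≉0 xy≈0 = begin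
    y                     ≈⟨ *-identityˡ y ⟨
    1# * y                ≈⟨ *-congʳ (*-inverseʳ x x≉0) ⟨
    x * x′ * y            ≈⟨ solve 3 (λ x x′ y → x :* x′ :* y := x′ :* (x :* y)) refl x x′ y ⟩
    x′ * (x * y)          ≈⟨ *-congˡ xy≈0 ⟩
    x′ * 0#               ≈⟨ zeroʳ x′ ⟩
    0#                    ∎
    where x′ = x ⁻¹[ x≉0 ]

  ^≈0⇒≈0 : ∀ x n → x ^ n ≈ 0# → x ≈ 0#
  ^≈0⇒≈0 x zero    1≈0  = contradiction (sym 1≈0) 0≉1
  ^≈0⇒≈0 x (suc n) xⁿ≈0 with x ≟ 0#
  ... | yes x≈0 = x≈0
  ... | no  x≉0 = ^≈0⇒≈0 x n (*-cancelˡ-0 x x≉0 xⁿ≈0)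

  0^n≈0 : ∀ {n} → 0 < n → 0# ^ n ≈ 0#
  0^n≈0 (s≤s _) = zeroˡ _

  1^n≈1 : ∀ n → 1# ^ n ≈ 1#
  1^n≈1 zero    = refl
  1^n≈1 (suc n) = trans (*-identityˡ _) (1^n≈1 n)

  index : Carrier → Fin q
  index x = proj₁ (enum-surj x)

  enum-index : ∀ x → enum (index x) ≈ x
  enum-index x = proj₂ (enum-surj x)

  index-unique : ∀ {x} i → enum i ≈ x → index x ≡ i
  index-unique i eᵢ≈x = enum-inj _ _ (trans (enum-index _) (sym eᵢ≈x))

  module _ (M : CommutativeMonoid 0ℓ 0ℓ) where
    private module M = CommutativeMonoid M
    private module Sum = Algebra.Properties.CommutativeMonoid.Sum M

    -- Conjugation by `enum` and `index` turns a bijection of the field into a permutation of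
    -- `Fin q`. The monoid is a parameter because translations are applied to a sum and scalings to
    -- a product.
    sum-reindex : (h h⁻ : Carrier → Carrier) →
      (∀ {x y} → x ≈ y → h x ≈ h y) → (∀ {x y} → x ≈ y → h⁻ x ≈ h⁻ y) →
      (∀ x → h (h⁻ x) ≈ x) → (∀ x → h⁻ (h x) ≈ x) →
      (f : Carrier → M.Carrier) → (∀ {x y} → x ≈ y → f x M.≈ f y) →
      Sum.sum (f ∘ enum) M.≈ Sum.sum (f ∘ h ∘ enum)
    sum-reindex h h⁻ h-cong h⁻-cong hh⁻ h⁻h f f-cong = M.trans
      (Sum.sum-permute (f ∘ enum) (permutation (index ∘ h ∘ enum) (index ∘ h⁻ ∘ enum)
        (λ i → index-unique i (sym (trans (h-cong (enum-index _)) (hh⁻ _))))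
        (λ i → index-unique i (sym (trans (h⁻-cong (enum-index _)) (h⁻h _))))))
      (Sum.sum-cong-≋ {q} (λ i → f-cong (enum-index (h (enum i)))))

  -- Translation by 1 permutes F, so comparing the sums of all elements before and after gives q · 1 = 0.
  q·1≈0 : q · 1# ≈ 0#
  q·1≈0 = identityʳ-unique (sum enum) (q · 1#) (sym (begin
    sum enum                        ≈⟨ sum-reindex +-commutativeMonoid (_+ 1#) (_+ - 1#) +-congʳ +-congʳ
                                         (λ x → cancel x (-‿inverseˡ 1#)) (λ x → cancel x (-‿inverseʳ 1#)) id id ⟩
    sum (λ i → enum i + 1#)         ≈⟨ ∑-distrib-+ enum (λ _ → 1#) ⟩
    sum enum + sum {q} (λ _ → 1#)   ≈⟨ +-congˡ (sum-replicate q) ⟩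
    sum enum + q · 1#               ∎))
    where
    cancel : ∀ x {y z} → y + z ≈ 0# → x + y + z ≈ x
    cancel x y+z≈0 = trans (+-assoc _ _ _) (trans (+-congˡ y+z≈0) (+-identityʳ x))

  -- The multiple `q · 1#` is the power `(1# + 1#) ^ suc m`, and a field has no nilpotent elements
  -- except 0.
  1+1≈0 : 1# + 1# ≈ 0#
  1+1≈0 = ^≈0⇒≈0 _ (suc m) (trans (sym (2^k·1 (suc m))) q·1≈0)
    where
    2^k·1 : ∀ k → (2 ℕ.^ k) · 1# ≈ (1# + 1#) ^ k
    2^k·1 zero    = +-identityʳ 1#
    2^k·1 (suc k) = trans (×1-homo-* 2 (2 ℕ.^ k))
      (*-cong (+-congˡ (+-identityʳ 1#)) (2^k·1 k))

  x+x≈0 : ∀ x → x + x ≈ 0#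
  x+x≈0 x = begin
    x + x            ≈⟨ solve 1 (λ x → x :+ x := (con 1 :+ con 1) :* x) refl x ⟩
    (1# + 1#) * x    ≈⟨ *-congʳ 1+1≈0 ⟩
    0# * x           ≈⟨ zeroˡ x ⟩
    0#               ∎

  x+y≈0⇒x≈y : ∀ {x y} → x + y ≈ 0# → x ≈ y
  x+y≈0⇒x≈y {x} {y} x+y≈0 = begin
    x              ≈⟨ +-identityʳ x ⟨
    x + 0#         ≈⟨ +-congˡ (x+x≈0 y) ⟨
    x + (y + y)    ≈⟨ +-assoc x y y ⟨
    x + y + y      ≈⟨ +-congʳ x+y≈0 ⟩
    0# + y         ≈⟨ +-identityˡ y ⟩
    y              ∎

  frobenius : ∀ x y k → (x + y) ^ (2 ℕ.^ k) ≈ x ^ (2 ℕ.^ k) + y ^ (2 ℕ.^ k)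
  frobenius x y zero    = solve 2 (λ x y → (x :+ y) :* con 1 := x :* con 1 :+ y :* con 1) refl x y
  frobenius x y (suc k) = begin
    (x + y) ^ (2 ℕ.* e)              ≈⟨ square (x + y) ⟩
    (x + y) ^ e * (x + y) ^ e        ≈⟨ *-cong (frobenius x y k) (frobenius x y k) ⟩
    (X + Y) * (X + Y)                ≈⟨ solve 2 (λ X Y → (X :+ Y) :* (X :+ Y) :=
                                          X :* X :+ Y :* Y :+ (X :* Y :+ X :* Y)) refl X Y ⟩
    X * X + Y * Y + (X * Y + X * Y)  ≈⟨ +-congˡ (x+x≈0 _) ⟩
    X * X + Y * Y + 0#               ≈⟨ +-identityʳ _ ⟩
    X * X + Y * Y                    ≈⟨ +-cong (square x) (square y) ⟨
    x ^ (2 ℕ.* e) + y ^ (2 ℕ.* e)    ∎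
    where
    e = 2 ℕ.^ k
    X = x ^ e
    Y = y ^ e
    square : ∀ z → z ^ (2 ℕ.* e) ≈ z ^ e * z ^ e
    square z = trans (^-homo-* z e (e ℕ.+ 0))
      (*-congˡ (reflexive (≡.cong (z ^_) (ℕₚ.+-identityʳ e))))

  unit : Carrier → Carrier
  unit y = if does (y ≟ 0#) then 1# else y

  unit-zero : ∀ {y} → y ≈ 0# → unit y ≈ 1#
  unit-zero {y} y≈0 with y ≟ 0#
  ... | yes _   = refl
  ... | no  y≉0 = contradiction y≈0 y≉0

  unit-nonzero : ∀ {y} → ¬ y ≈ 0# → unit y ≈ y
  unit-nonzero {y} y≉0 with y ≟ 0#
  ... | yes y≈0 = contradiction y≈0 y≉0
  ... | no  _   = refl

  unit-cong : ∀ {x y} → x ≈ y → unit x ≈ unit y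
  unit-cong {x} {y} x≈y with y ≟ 0#
  ... | yes y≈0 = unit-zero (trans x≈y y≈0)
  ... | no  y≉0 = trans (unit-nonzero (y≉0 ∘ trans (sym x≈y))) x≈y

  unit≉0 : ∀ y → ¬ unit y ≈ 0#
  unit≉0 y with y ≟ 0#
  ... | yes _   = 0≉1 ∘ sym
  ... | no  y≉0 = y≉0

  ∏≉0 : ∀ {n} (f : Fin n → Carrier) → (∀ i → ¬ f i ≈ 0#) → ¬ ∏.sum f ≈ 0#
  ∏≉0 {zero}  f f≉0 1≈0 = 0≉1 (sym 1≈0)
  ∏≉0 {suc n} f f≉0 p≈0 = ∏≉0 (f ∘ Fin.suc) (f≉0 ∘ Fin.suc) (*-cancelˡ-0 _ (f≉0 Fin.zero) p≈0)

  -- Multiplication by x ≠ 0 permutes F; compare the products of all elements, 0 being replaced by 1.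
  x^q≈x : ∀ x → x ^ q ≈ x
  x^q≈x x with x ≟ 0#
  ... | yes x≈0 = trans (^-congˡ q x≈0) (trans (0^n≈0 (ℕₚ.m^n>0 2 (suc m))) (sym x≈0))
  ... | no  x≉0 = sym (x+y≈0⇒x≈y (*-cancelˡ-0 P P≉0 (begin
    P * (x + x ^ q)      ≈⟨ solve 3 (λ P x y → P :* (x :+ y) := P :* x :+ y :* P) refl P x (x ^ q) ⟩
    P * x + x ^ q * P    ≈⟨ +-congˡ x^qP≈Px ⟩
    P * x + P * x        ≈⟨ x+x≈0 _ ⟩
    0#                   ∎)))
    where
    x′ = x ⁻¹[ x≉0 ]

    P = ∏.sum (unit ∘ enum)

    P≉0 : ¬ P ≈ 0#
    P≉0 = ∏≉0 (unit ∘ enum) (unit≉0 ∘ enum)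

    -- At y = 0, `x * unit y` is x while `unit (x * y)` is 1. This one extra factor x is why the
    -- exponent comes out as q and not q - 1.
    c : Carrier → Carrier
    c y = if does (y ≟ 0#) then x else 1#

    unit-* : ∀ y → x * unit y ≈ unit (x * y) * c y
    unit-* y with y ≟ 0#
    ... | yes y≈0 = trans (*-identityʳ x) (sym (trans (*-congʳ (unit-zero (trans (*-congˡ y≈0) (zeroʳ x)))) (*-identityˡ x)))
    ... | no  y≉0 = sym (trans (*-identityʳ _) (unit-nonzero (y≉0 ∘ *-cancelˡ-0 x x≉0)))

    c-zero : ∀ {y} → y ≈ 0# → c y ≈ x
    c-zero {y} y≈0 with y ≟ 0#
    ... | yes _   = refl
    ... | no  y≉0 = contradiction y≈0 y≉0

    c-nonzero : ∀ {y} → ¬ y ≈ 0# → c y ≈ 1#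
    c-nonzero {y} y≉0 with y ≟ 0#
    ... | yes y≈0 = contradiction y≈0 y≉0
    ... | no  _   = refl

    xx′y≈y : ∀ y → x * (x′ * y) ≈ y
    xx′y≈y y = trans (sym (*-assoc _ _ _)) (trans (*-congʳ (*-inverseʳ x x≉0)) (*-identityˡ y))

    x′xy≈y : ∀ y → x′ * (x * y) ≈ y
    x′xy≈y y = trans (solve 3 (λ x x′ y → x′ :* (x :* y) := x :* (x′ :* y)) refl x x′ y) (xx′y≈y y)

    x^qP≈Px : x ^ q * P ≈ P * x
    x^qP≈Px = begin
      x ^ q * P                                          ≈⟨ *-congʳ (∏.sum-replicate q) ⟨
      ∏.sum {q} (λ _ → x) * P                            ≈⟨ ∏.∑-distrib-+ (λ _ → x) (unit ∘ enum) ⟨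
      ∏.sum (λ i → x * unit (enum i))                    ≈⟨ ∏.sum-cong-≋ (unit-* ∘ enum) ⟩
      ∏.sum (λ i → unit (x * enum i) * c (enum i))       ≈⟨ ∏.∑-distrib-+ (λ i → unit (x * enum i)) (c ∘ enum) ⟩
      ∏.sum (λ i → unit (x * enum i)) * ∏.sum (c ∘ enum) ≈⟨ *-cong
        (sym (sum-reindex *-commutativeMonoid (x *_) (x′ *_) *-congˡ *-congˡ xx′y≈y x′xy≈y unit unit-cong))
        (trans (sum-single *-commutativeMonoid (c ∘ enum) (index 0#)
                 (λ j j≢0 → c-nonzero (j≢0 ∘ ≡.sym ∘ index-unique j)))
               (c-zero (enum-index 0#))) ⟩
      P * x                                              ∎

-- Polynomial functions and the trace form

module Trace {m : ℕ} (F : FiniteField (suc m)) where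
  open FiniteField F
  open FieldTheory F
  open import Algebra.Properties.Semiring.Sum semiring
  open import Algebra.Properties.Semiring.Exp semiring
  open import Algebra.Solver.Ring.NaturalCoefficients.Default commutativeSemiring
    using (solve; _:=_; _:+_; _:*_; con)
  open import Relation.Binary.Reasoning.Setoid setoid

  -- Poly d f: f is a polynomial function of degree < d, in Horner form.
  Poly : ℕ → (Carrier → Carrier) → Set
  Poly zero    f = ∀ x → f x ≈ 0#
  Poly (suc d) f = ∃ λ c → ∃ λ g → Poly d g × (∀ x → f x ≈ c + x * g x)

  Poly-resp : ∀ d {f g} → (∀ x → g x ≈ f x) → Poly d f → Poly d g
  Poly-resp zero    g≈f f≈0             = λ x → trans (g≈f x) (f≈0 x)
  Poly-resp (suc d) g≈f (c , h , p , f≈) = c , h , p , λ x → trans (g≈f x) (f≈ x)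

  Poly-0 : ∀ d → Poly d (λ _ → 0#)
  Poly-0 zero    = λ _ → refl
  Poly-0 (suc d) = 0# , (λ _ → 0#) , Poly-0 d , λ x → sym (trans (+-identityˡ _) (zeroʳ x))

  Poly-mono : ∀ {d e f} → d ≤ e → Poly d f → Poly e f
  Poly-mono {e = e} z≤n f≈0              = Poly-resp e f≈0 (Poly-0 e)
  Poly-mono (s≤s d≤e) (c , g , p , f≈) = c , g , Poly-mono d≤e p , f≈

  Poly-+ : ∀ d {f g} → Poly d f → Poly d g → Poly d (λ x → f x + g x)
  Poly-+ zero    f≈0 g≈0 = λ x → trans (+-cong (f≈0 x) (g≈0 x)) (+-identityˡ 0#)
  Poly-+ (suc d) (c , f , p , f≈) (c′ , g , p′ , g≈) =
    c + c′ , (λ x → f x + g x) , Poly-+ d p p′ , λ x → trans (+-cong (f≈ x) (g≈ x))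
      (solve 5 (λ c c′ x f g → (c :+ x :* f) :+ (c′ :+ x :* g) := (c :+ c′) :+ x :* (f :+ g))
         refl c c′ x (f x) (g x))

  Poly-* : ∀ d a {f} → Poly d f → Poly d (λ x → a * f x)
  Poly-* zero    a f≈0 = λ x → trans (*-congˡ (f≈0 x)) (zeroʳ a)
  Poly-* (suc d) a (c , f , p , f≈) = a * c , (λ x → a * f x) , Poly-* d a p , λ x →
    trans (*-congˡ (f≈ x))
      (solve 4 (λ a c x f → a :* (c :+ x :* f) := a :* c :+ x :* (a :* f)) refl a c x (f x))

  Poly-^ : ∀ n → Poly (suc n) (_^ n)
  Poly-^ zero    = 1# , (λ _ → 0#) , (λ _ → refl) , λ x → sym (trans (+-congˡ (zeroʳ x)) (+-identityʳ 1#))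
  Poly-^ (suc n) = 0# , (_^ n) , Poly-^ n , λ x → sym (+-identityˡ _)

  Poly-sum : ∀ {n} d (f : Fin n → Carrier → Carrier) →
             (∀ i → Poly d (f i)) → Poly d (λ x → sum (λ i → f i x))
  Poly-sum {zero}  d f p = Poly-0 d
  Poly-sum {suc n} d f p = Poly-+ d (p Fin.zero) (Poly-sum d (f ∘ Fin.suc) (p ∘ Fin.suc))

  -- Minus signs are plus signs in characteristic 2: this is f(x) − f(a) = (x − a) g(x).
  factor : ∀ d {f} → Poly (suc d) f → ∀ a → ∃ λ g → Poly d g × (∀ x → f x + f a ≈ (x + a) * g x)
  factor zero {f} (c , h , h≈0 , f≈) a = (λ _ → 0#) , (λ _ → refl) , λ x → begin
    f x + f a                          ≈⟨ +-cong (f≈ x) (f≈ a) ⟩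
    (c + x * h x) + (c + a * h a)      ≈⟨ +-cong (+-congˡ (*-congˡ (h≈0 x))) (+-congˡ (*-congˡ (h≈0 a))) ⟩
    (c + x * 0#) + (c + a * 0#)        ≈⟨ solve 3 (λ c x a → (c :+ x :* con 0) :+ (c :+ a :* con 0) := c :+ c)
                                            refl c x a ⟩
    c + c                              ≈⟨ x+x≈0 c ⟩
    0#                                 ≈⟨ zeroʳ _ ⟨
    (x + a) * 0#                       ∎
  factor (suc d) {f} (c , h , p , f≈) a with factor d p a
  -- The quotient comes from x h(x) - a h(a) = (x - a) h(x) + a (h(x) - h(a)). Adding `a * h x`
  -- twice below creates this splitting without negatives.
  ... | k , pk , h≈ = (λ x → h x + a * k x)
    , Poly-+ (suc d) p (Poly-mono (ℕₚ.n≤1+n d) (Poly-* d a pk)) , λ x → begin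
    f x + f a                                          ≈⟨ +-cong (f≈ x) (f≈ a) ⟩
    (c + x * h x) + (c + a * h a)                      ≈⟨ +-identityʳ _ ⟨
    (c + x * h x) + (c + a * h a) + 0#                 ≈⟨ +-congˡ (x+x≈0 (a * h x)) ⟨
    (c + x * h x) + (c + a * h a) + (a * h x + a * h x) ≈⟨ solve 5 (λ c x a hx ha →
        (c :+ x :* hx) :+ (c :+ a :* ha) :+ (a :* hx :+ a :* hx) :=
        (c :+ c) :+ ((x :+ a) :* hx :+ a :* (hx :+ ha))) refl c x a (h x) (h a) ⟩
    (c + c) + ((x + a) * h x + a * (h x + h a))        ≈⟨ +-cong (x+x≈0 c) (+-congˡ (*-congˡ (h≈ x))) ⟩
    0# + ((x + a) * h x + a * ((x + a) * k x))         ≈⟨ solve 4 (λ x a hx kx →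
        con 0 :+ ((x :+ a) :* hx :+ a :* ((x :+ a) :* kx)) := (x :+ a) :* (hx :+ a :* kx)) refl x a (h x) (k x) ⟩
    (x + a) * (h x + a * k x)                          ∎

  -- The first root splits off a linear factor, and by injectivity the other points are roots of the
  -- quotient.
  roots⇒zero : ∀ d {f} → Poly d f → (xs : Fin d → Carrier) → (∀ i j → xs i ≈ xs j → i ≡ j) →
               (∀ i → f (xs i) ≈ 0#) → ∀ x → f x ≈ 0#
  roots⇒zero zero    f≈0 xs inj f0 = f≈0
  roots⇒zero (suc d) {f} p xs inj f0 x with factor d p (xs Fin.zero)
  ... | g , pg , f≈ = begin
    f x              ≈⟨ +-identityʳ _ ⟨
    f x + 0#         ≈⟨ +-congˡ (f0 Fin.zero) ⟨
    f x + f a        ≈⟨ f≈ x ⟩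
    (x + a) * g x    ≈⟨ *-congˡ (roots⇒zero d pg (xs ∘ Fin.suc)
                          (λ i j eq → Finₚ.suc-injective (inj _ _ eq)) g0 x) ⟩
    (x + a) * 0#     ≈⟨ zeroʳ _ ⟩
    0#               ∎
    where
    a = xs Fin.zero
    g0 : ∀ i → g (xs (Fin.suc i)) ≈ 0#
    g0 i = *-cancelˡ-0 (xs (Fin.suc i) + a)
      (λ eq → contradiction (≡.sym (inj _ _ (x+y≈0⇒x≈y eq))) Finₚ.0≢1+n)
      (trans (sym (f≈ _)) (trans (+-cong (f0 (Fin.suc i)) (f0 Fin.zero)) (+-identityˡ 0#)))

  -- The q - 1 nonzero elements are already enough roots. Each use divides or multiplies by a power
  -- of x away from 0, and then contradicts or exploits the constant term.
  vanishes-at-0 : ∀ {d f} → d < q → Poly d f → (∀ x → ¬ x ≈ 0# → f x ≈ 0#) → f 0# ≈ 0#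
  vanishes-at-0 {d} {f} d<q p f0 = from-suc q ≡.refl d<q
    where
    -- The power `q` does not reduce to a successor, so a successor equal to it is matched instead;
    -- `punchIn o` then skips the index of 0.
    from-suc : ∀ n → q ≡ n → d < n → f 0# ≈ 0#
    from-suc (suc n) q≡n (s≤s d≤n) = roots⇒zero d p xs
      (λ i j eq → Finₚ.inject≤-injective d≤n d≤n i j
        (Finₚ.punchIn-injective o _ _ (cast-injective (enum-inj _ _ eq))))
      (λ i → f0 _ (λ x≈0 → Finₚ.punchInᵢ≢i o (Fin.inject≤ i d≤n)
        (≡.trans (≡.sym (Finₚ.cast-involutive q≡n (≡.sym q≡n) _))
                 (≡.cong (Fin.cast q≡n) (≡.sym (index-unique _ x≈0))))))
      0#
      where
      o = Fin.cast q≡n (index 0#)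

      cast-injective : ∀ {i j} → Fin.cast (≡.sym q≡n) i ≡ Fin.cast (≡.sym q≡n) j → i ≡ j
      cast-injective eq = ≡.trans (≡.sym (Finₚ.cast-involutive q≡n (≡.sym q≡n) _))
        (≡.trans (≡.cong (Fin.cast q≡n) eq) (Finₚ.cast-involutive q≡n (≡.sym q≡n) _))

      xs : Fin d → Carrier
      xs i = enum (Fin.cast (≡.sym q≡n) (Fin.punchIn o (Fin.inject≤ i d≤n)))

  Σ≡sum : ∀ n (f : Fin n → Carrier) → Σ[<_]_ F n f ≡ sum f
  Σ≡sum zero    f = ≡.refl
  Σ≡sum (suc n) f = ≡.cong (f Fin.zero +_) (Σ≡sum n (f ∘ Fin.suc))

  pow≡^ : ∀ x n → pow F x n ≡ x ^ n
  pow≡^ x zero    = ≡.refl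
  pow≡^ x (suc n) = ≡.cong (x *_) (pow≡^ x n)

  conj : Fin (suc m) → Carrier → Carrier
  conj i x = x ^ (2 ℕ.^ toℕ i)

  T : Carrier → Carrier
  T = trF F

  T≈sum : ∀ x → T x ≈ sum (λ i → conj i x)
  T≈sum x = reflexive (≡.trans (Σ≡sum (suc m) (λ i → pow F x (2 ℕ.^ toℕ i))) (sum-cong-≗ {suc m} (λ i → pow≡^ x (2 ℕ.^ toℕ i))))

  T-cong : ∀ {x y} → x ≈ y → T x ≈ T y
  T-cong {x} {y} x≈y = trans (T≈sum x)
    (trans (sum-cong-≋ {suc m} (λ i → ^-congˡ (2 ℕ.^ toℕ i) x≈y)) (sym (T≈sum y)))

  T-+ : ∀ x y → T (x + y) ≈ T x + T y
  T-+ x y = begin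
    T (x + y)                                  ≈⟨ T≈sum (x + y) ⟩
    sum (λ i → conj i (x + y))                 ≈⟨ sum-cong-≋ {suc m} (λ i → frobenius x y (toℕ i)) ⟩
    sum (λ i → conj i x + conj i y)            ≈⟨ ∑-distrib-+ (λ i → conj i x) (λ i → conj i y) ⟩
    sum (λ i → conj i x) + sum (λ i → conj i y) ≈⟨ +-cong (T≈sum x) (T≈sum y) ⟨
    T x + T y                                  ∎

  T-0 : T 0# ≈ 0#
  T-0 = begin
    T 0#            ≈⟨ T-cong (+-identityˡ 0#) ⟨
    T (0# + 0#)     ≈⟨ T-+ 0# 0# ⟩
    T 0# + T 0#     ≈⟨ x+x≈0 _ ⟩
    0#              ∎

  T-sum : ∀ {n} (f : Fin n → Carrier) → T (sum f) ≈ sum (T ∘ f)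
  T-sum {zero}  f = T-0
  T-sum {suc n} f = trans (T-+ _ _) (+-congˡ (T-sum (f ∘ Fin.suc)))

  -- Squaring permutes the conjugates cyclically.
  T²≈T : ∀ x → T x * T x ≈ T x
  T²≈T x = begin
    T x * T x                    ≈⟨ solve 1 (λ t → t :* t := t :* (t :* con 1)) refl (T x) ⟩
    T x ^ 2                      ≈⟨ ^-congˡ 2 (T≈sum x) ⟩
    S ^ 2                        ≈⟨ square-sum (λ i → conj i x) ⟩
    sum (λ i → conj i x ^ 2)     ≈⟨ sum-cong-≋ {suc m} (λ i → trans (^-assocʳ x (2 ℕ.^ toℕ i) 2)
                                      (^-congʳ x (ℕₚ.*-comm (2 ℕ.^ toℕ i) 2))) ⟩
    S′                           ≈⟨ x+y≈0⇒x≈y S′+S≈0 ⟩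
    S                            ≈⟨ T≈sum x ⟨
    T x                          ∎
    where
    h : ℕ → Carrier
    h k = x ^ (2 ℕ.^ k)
    S  = sum {suc m} (λ i → h (toℕ i))
    S′ = sum {suc m} (λ i → h (suc (toℕ i)))
    square-sum : ∀ {n} (f : Fin n → Carrier) → sum f ^ 2 ≈ sum (λ i → f i ^ 2)
    square-sum {zero}  f = zeroˡ _
    square-sum {suc n} f = trans (frobenius _ _ 1) (+-congˡ (square-sum (f ∘ Fin.suc)))
    S′+S≈0 : S′ + S ≈ 0#
    S′+S≈0 = begin
      S′ + S                   ≈⟨ +-identityˡ _ ⟨
      0# + (S′ + S)            ≈⟨ +-congʳ (x+x≈0 x) ⟨
      (x + x) + (S′ + S)       ≈⟨ solve 3 (λ x s′ s → (x :+ x) :+ (s′ :+ s) := (x :* con 1 :+ s′) :+ (s :+ x)) refl x S′ S ⟩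
      (h 0 + S′) + (S + x)     ≈⟨ +-congʳ (sum-telescope +-commutativeMonoid (suc m) h) ⟩
      (S + h (suc m)) + (S + x) ≈⟨ +-congʳ (+-congˡ (x^q≈x x)) ⟩
      (S + x) + (S + x)        ≈⟨ x+x≈0 _ ⟩
      0#                       ∎

  T≈0⊎T≈1 : ∀ x → T x ≈ 0# ⊎ T x ≈ 1#
  T≈0⊎T≈1 x with T x ≟ 0#
  ... | yes T≈0 = inj₁ T≈0
  ... | no  T≉0 = inj₂ (x+y≈0⇒x≈y (*-cancelˡ-0 (T x) T≉0 (begin
    T x * (T x + 1#)     ≈⟨ solve 1 (λ t → t :* (t :+ con 1) := t :* t :+ t) refl (T x) ⟩
    T x * T x + T x      ≈⟨ +-congʳ (T²≈T x) ⟩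
    T x + T x            ≈⟨ x+x≈0 _ ⟩
    0#                   ∎)))

  -- T(x) = x h(x) with h(0) = 1 and h of degree < q − 1.
  T≢0 : ¬ (∀ x → T x ≈ 0#)
  T≢0 T≈0 = 0≉1 (trans (sym h0≈0) h0≈1)
    where
    e : Fin (suc m) → ℕ
    e i = 2 ℕ.^ toℕ i ∸ 1

    2^≡suc : ∀ k → suc (2 ℕ.^ k ∸ 1) ≡ 2 ℕ.^ k
    2^≡suc k = ℕₚ.m+[n∸m]≡n (ℕₚ.m^n>0 2 k)

    h : Carrier → Carrier
    h x = sum (λ i → x ^ e i)

    T≈xh : ∀ x → T x ≈ x * h x
    T≈xh x = trans (T≈sum x) (trans
      (sum-cong-≋ {suc m} (λ i → ^-congʳ x (≡.sym (2^≡suc (toℕ i)))))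
      (sym (*-distribˡ-sum x (λ i → x ^ e i))))

    Poly-h : Poly (2 ℕ.^ m) h
    Poly-h = Poly-sum _ (λ i x → x ^ e i) (λ i → Poly-mono
      (ℕₚ.≤-trans (ℕₚ.≤-reflexive (2^≡suc (toℕ i))) (ℕₚ.^-monoʳ-≤ 2 (ℕₚ.≤-pred (Finₚ.toℕ<n i))))
      (Poly-^ (e i)))

    h0≈0 : h 0# ≈ 0#
    h0≈0 = vanishes-at-0 (ℕₚ.^-monoʳ-< 2 (s≤s (s≤s z≤n)) (ℕₚ.n<1+n m)) Poly-h
      (λ x x≉0 → *-cancelˡ-0 x x≉0 (trans (sym (T≈xh x)) (T≈0 x)))

    h0≈1 : h 0# ≈ 1#
    h0≈1 = sum-single +-commutativeMonoid (λ i → 0# ^ e i) Fin.zero λ where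
      Fin.zero    0≢0 → contradiction ≡.refl 0≢0
      (Fin.suc i) _   → 0^n≈0 {e (Fin.suc i)} (ℕₚ.∸-monoˡ-≤ 1 (ℕₚ.^-monoʳ-≤ 2 {1} {toℕ (Fin.suc i)} (s≤s z≤n)))

  T-nondegenerate : ∀ {a} → (∀ x → T (a * x) ≈ 0#) → a ≈ 0#
  T-nondegenerate {a} Ta≈0 with a ≟ 0#
  ... | yes a≈0 = a≈0
  ... | no  a≉0 = contradiction (λ x → trans (T-cong (begin
    x                ≈⟨ *-identityˡ x ⟨
    1# * x           ≈⟨ *-congʳ (*-inverseʳ a a≉0) ⟨
    a * a′ * x       ≈⟨ *-assoc _ _ _ ⟩
    a * (a′ * x)     ∎)) (Ta≈0 _)) T≢0
    where a′ = a ⁻¹[ a≉0 ]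

-- The trace form on the values x + x⁻¹

2+2^k≤2^n : ∀ {k n} → 2 ≤ n → k < n → 2 ℕ.+ 2 ℕ.^ k ≤ 2 ℕ.^ n
2+2^k≤2^n {n = suc n} (s≤s 1≤n) (s≤s k≤n) = ℕₚ.+-mono-≤ (ℕₚ.^-monoʳ-≤ 2 1≤n)
  (ℕₚ.≤-trans (ℕₚ.^-monoʳ-≤ 2 k≤n) (ℕₚ.m≤m+n (2 ℕ.^ n) 0))

-- With n = m this is the degree bound q/2 + e ≤ q - 2 for the powers e = 2^k below q/2. It is the
-- place where q ≥ 8 is used.
2+2^n+2^k≤2^[1+n] : ∀ {k n} → 2 ≤ n → k < n → 2 ℕ.+ (2 ℕ.^ n ℕ.+ 2 ℕ.^ k) ≤ 2 ℕ.^ suc n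
2+2^n+2^k≤2^[1+n] {k} {n} 2≤n k<n = begin
  2 ℕ.+ (2 ℕ.^ n ℕ.+ 2 ℕ.^ k)     ≡⟨ ℕₚ.+-comm 2 _ ⟩
  2 ℕ.^ n ℕ.+ 2 ℕ.^ k ℕ.+ 2       ≡⟨ ℕₚ.+-assoc (2 ℕ.^ n) _ 2 ⟩
  2 ℕ.^ n ℕ.+ (2 ℕ.^ k ℕ.+ 2)     ≡⟨ ≡.cong (2 ℕ.^ n ℕ.+_) (ℕₚ.+-comm _ 2) ⟩
  2 ℕ.^ n ℕ.+ (2 ℕ.+ 2 ℕ.^ k)     ≤⟨ ℕₚ.+-monoʳ-≤ (2 ℕ.^ n) (2+2^k≤2^n 2≤n k<n) ⟩
  2 ℕ.^ n ℕ.+ 2 ℕ.^ n             ≤⟨ ℕₚ.+-monoʳ-≤ (2 ℕ.^ n) (ℕₚ.m≤m+n (2 ℕ.^ n) 0) ⟩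
  2 ℕ.^ suc n                     ∎
  where open ℕₚ.≤-Reasoning

module Inversion {m : ℕ} (F : FiniteField (suc m)) where
  open FiniteField F
  open FieldTheory F
  open Trace F
  open import Algebra.Properties.Semiring.Sum semiring
  open import Algebra.Properties.Semiring.Exp semiring
  open import Algebra.Properties.CommutativeSemiring.Exp commutativeSemiring using (^-distrib-*)
  open import Algebra.Solver.Ring.NaturalCoefficients.Default commutativeSemiring
    using (solve; _:=_; _:+_; _:*_; con)
  open import Relation.Binary.Reasoning.Setoid setoid

  -- Otherwise the linear polynomial x + 1 would also vanish at 0, where it is 1. This supplies a
  -- scalar other than 0 and 1 when q ≥ 4.
  x+1-nonvanishing : 1 ≤ m → ¬ (∀ x → ¬ x ≈ 0# → x + 1# ≈ 0#)
  x+1-nonvanishing 1≤m x+1≈0 = 0≉1 (trans (sym (vanishes-at-0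
      (ℕₚ.^-monoʳ-< 2 (s≤s (s≤s z≤n)) (s≤s 1≤m)) Poly-x+1 x+1≈0)) (+-identityˡ 1#))
    where
    Poly-x+1 : Poly 2 (_+ 1#)
    Poly-x+1 = 1# , (_^ 0) , Poly-^ 0 , λ x → solve 1 (λ x → x :+ con 1 := con 1 :+ x :* con 1) refl x

  -- Let Q = q/2.  For x ≠ 0, x^Q T(a(x + x⁻¹)) is the sum over e = 2^i of the a^e (x^(Q+e) + x^(Q∸e)).
  -- For e = Q the bracket is x^q + 1 = x + 1; the others have degree < q − 1 and vanish at 0.
  -- So we get a polynomial of degree < q − 1 whose value at 0 is a^Q.
  T-inversion-nondegenerate : 2 ≤ m → ∀ {a} → (∀ x x′ → x * x′ ≈ 1# → T (a * (x + x′)) ≈ 0#) → a ≈ 0#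
  T-inversion-nondegenerate 2≤m {a} Ta≈0 = ^≈0⇒≈0 a Q (begin
    a ^ Q                              ≈⟨ G-last ⟨
    G (Fin.fromℕ m) 0#                 ≈⟨ sum-single +-commutativeMonoid (λ i → G i 0#) (Fin.fromℕ m) G-other ⟨
    sum (λ i → G i 0#)                 ≈⟨ vanishes-at-0 q∸1<q Poly-G ∑G≈0 ⟩
    0#                                 ∎)
    where
    -- `Q` is the largest exponent occurring in the trace, so `x ^ Q` clears every denominator
    -- `x′ ^ e i`.
    Q : ℕ
    Q = 2 ℕ.^ m

    e : Fin (suc m) → ℕ
    e i = 2 ℕ.^ toℕ i

    bracket : Fin (suc m) → Carrier → Carrier
    bracket i x with toℕ i ℕ.≟ m
    ... | yes _ = x + 1#
    ... | no  _ = x ^ (Q ℕ.+ e i) + x ^ (Q ∸ e i)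

    G : Fin (suc m) → Carrier → Carrier
    G i x = a ^ e i * bracket i x

    q∸1<q : q ∸ 1 < q
    q∸1<q = ℕₚ.≤-reflexive (ℕₚ.m+[n∸m]≡n (ℕₚ.m^n>0 2 (suc m)))

    toℕ≢m⇒<m : ∀ i → toℕ i ≢ m → toℕ i < m
    toℕ≢m⇒<m i i≢m = ℕₚ.≤∧≢⇒< (ℕₚ.≤-pred (Finₚ.toℕ<n i)) i≢m

    Poly-bracket : ∀ i → Poly (q ∸ 1) (bracket i)
    Poly-bracket i with toℕ i ℕ.≟ m
    ... | yes _ = Poly-mono 2≤q∸1
      (1# , (_^ 0) , Poly-^ 0 , λ x → solve 1 (λ x → x :+ con 1 := con 1 :+ x :* con 1) refl x)
      where
      2≤q∸1 : 2 ≤ q ∸ 1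
      2≤q∸1 = ℕₚ.∸-monoˡ-≤ {3} 1 (ℕₚ.≤-trans (ℕₚ.+-monoʳ-≤ 2 (ℕₚ.≤-trans (ℕₚ.m^n>0 2 m) (ℕₚ.m≤m+n Q 1)))
        (2+2^n+2^k≤2^[1+n] 2≤m (ℕₚ.<-≤-trans (s≤s z≤n) 2≤m)))
    ... | no i≢m = Poly-+ (q ∸ 1) (Poly-mono deg (Poly-^ _))
      (Poly-mono (ℕₚ.≤-trans (s≤s (ℕₚ.≤-trans (ℕₚ.m∸n≤m Q (e i)) (ℕₚ.m≤m+n Q (e i)))) deg) (Poly-^ _))
      where
      deg : suc (Q ℕ.+ e i) ≤ q ∸ 1
      deg = ℕₚ.∸-monoˡ-≤ 1 (2+2^n+2^k≤2^[1+n] 2≤m (toℕ≢m⇒<m i i≢m))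

    Poly-G : Poly (q ∸ 1) (λ x → sum (λ i → G i x))
    Poly-G = Poly-sum (q ∸ 1) G (λ i → Poly-* (q ∸ 1) (a ^ e i) (Poly-bracket i))

    G-other : ∀ i → i ≢ Fin.fromℕ m → G i 0# ≈ 0#
    G-other i i≢last with toℕ i ℕ.≟ m
    ... | yes i≡m = contradiction (Finₚ.toℕ-injective (≡.trans i≡m (≡.sym (Finₚ.toℕ-fromℕ m)))) i≢last
    ... | no  i≢m = trans (*-congˡ (trans (+-cong
        (0^n≈0 (ℕₚ.<-≤-trans (ℕₚ.m^n>0 2 m) (ℕₚ.m≤m+n Q (e i))))
        (0^n≈0 (ℕₚ.m<n⇒0<n∸m (ℕₚ.^-monoʳ-< 2 (s≤s (s≤s z≤n)) (toℕ≢m⇒<m i i≢m)))))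
      (+-identityˡ 0#))) (zeroʳ _)

    G-last : G (Fin.fromℕ m) 0# ≈ a ^ Q
    G-last with toℕ (Fin.fromℕ m) ℕ.≟ m
    ... | yes i≡m = trans (*-cong (^-congʳ a (≡.cong (2 ℕ.^_) i≡m)) (+-identityˡ 1#)) (*-identityʳ _)
    ... | no  i≢m = contradiction (Finₚ.toℕ-fromℕ m) i≢m

    module _ {x x′} (xx′≈1 : x * x′ ≈ 1#) where
      bracket≈ : ∀ i → x ^ Q * (x ^ e i + x′ ^ e i) ≈ bracket i x
      bracket≈ i = trans expand collapse
        where
        E = e i

        x^Qx′^E : x ^ Q * x′ ^ E ≈ x ^ (Q ∸ E)
        x^Qx′^E = begin
          x ^ Q * x′ ^ E                 ≈⟨ *-congʳ (^-congʳ x (≡.sym (ℕₚ.m∸n+n≡m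
                                              (ℕₚ.^-monoʳ-≤ 2 (ℕₚ.≤-pred (Finₚ.toℕ<n i)))))) ⟩
          x ^ (Q ∸ E ℕ.+ E) * x′ ^ E     ≈⟨ *-congʳ (^-homo-* x (Q ∸ E) E) ⟩
          x ^ (Q ∸ E) * x ^ E * x′ ^ E   ≈⟨ *-assoc _ _ _ ⟩
          x ^ (Q ∸ E) * (x ^ E * x′ ^ E) ≈⟨ *-congˡ (^-distrib-* x x′ E) ⟨
          x ^ (Q ∸ E) * (x * x′) ^ E     ≈⟨ *-congˡ (trans (^-congˡ E xx′≈1) (1^n≈1 E)) ⟩
          x ^ (Q ∸ E) * 1#               ≈⟨ *-identityʳ _ ⟩
          x ^ (Q ∸ E)                    ∎

        expand : x ^ Q * (x ^ E + x′ ^ E) ≈ x ^ (Q ℕ.+ E) + x ^ (Q ∸ E)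
        expand = trans (distribˡ _ _ _) (+-cong (sym (^-homo-* x Q E)) x^Qx′^E)

        collapse : x ^ (Q ℕ.+ E) + x ^ (Q ∸ E) ≈ bracket i x
        collapse with toℕ i ℕ.≟ m
        ... | no  _   = refl
        -- Here `Q + e i` is `q`, up to the trailing `+ 0` of the unfolded power, so x^q = x
        -- applies; and `Q ∸ e i` is 0.
        ... | yes i≡m = +-cong
          (trans (^-congʳ x (≡.cong (Q ℕ.+_) (≡.trans (≡.cong (2 ℕ.^_) i≡m) (≡.sym (ℕₚ.+-identityʳ Q)))))
                 (x^q≈x x))
          (^-congʳ x (≡.trans (≡.cong (λ k → Q ∸ 2 ℕ.^ k) i≡m) (ℕₚ.n∸n≡0 Q)))

      ∑G≈x^QT : sum (λ i → G i x) ≈ x ^ Q * T (a * (x + x′))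
      ∑G≈x^QT = begin
        sum (λ i → G i x)                              ≈⟨ sum-cong-≋ {suc m} term ⟩
        sum (λ i → x ^ Q * conj i (a * (x + x′)))      ≈⟨ *-distribˡ-sum (x ^ Q) (λ i → conj i (a * (x + x′))) ⟨
        x ^ Q * sum (λ i → conj i (a * (x + x′)))      ≈⟨ *-congˡ (T≈sum _) ⟨
        x ^ Q * T (a * (x + x′))                       ∎
        where
        term : ∀ i → G i x ≈ x ^ Q * conj i (a * (x + x′))
        term i = begin
          a ^ e i * bracket i x                        ≈⟨ *-congˡ (bracket≈ i) ⟨
          a ^ e i * (x ^ Q * (x ^ e i + x′ ^ e i))     ≈⟨ *-congˡ (*-congˡ (frobenius x x′ (toℕ i))) ⟨
          a ^ e i * (x ^ Q * (x + x′) ^ e i)           ≈⟨ solve 3 (λ A X Y → A :* (X :* Y) := X :* (A :* Y)) refl _ _ _ ⟩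
          x ^ Q * (a ^ e i * (x + x′) ^ e i)           ≈⟨ *-congˡ (^-distrib-* a (x + x′) (e i)) ⟨
          x ^ Q * conj i (a * (x + x′))                ∎

    ∑G≈0 : ∀ x → ¬ x ≈ 0# → sum (λ i → G i x) ≈ 0#
    ∑G≈0 x x≉0 = trans (∑G≈x^QT (*-inverseʳ x x≉0))
      (trans (*-congˡ (Ta≈0 x _ (*-inverseʳ x x≉0))) (zeroʳ _))

-- The code, its dual and linear algebra over F₂

module Code {m : ℕ} (F : FiniteField (suc m)) where
  open FiniteField F
  open FieldTheory F
  open Trace F
  open import Algebra.Properties.Semiring.Sum semiring
  open import Relation.Binary.Reasoning.Setoid setoid
  private module F₂ = CommutativeRing xor-∧-commutativeRing
  import Algebra.Properties.Semiring.Sum F₂.semiring as ⊕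

  -- The embedding of F₂ in the field: identities between bits are proved there and pulled back by
  -- `bit-injective`.
  bit : Bool → Carrier
  bit b = if b then 1# else 0#

  bit-xor : ∀ b c → bit (b xor c) ≈ bit b + bit c
  bit-xor false c     = sym (+-identityˡ _)
  bit-xor true  false = sym (+-identityʳ _)
  bit-xor true  true  = sym 1+1≈0

  bit-injective : ∀ {b c} → bit b ≈ bit c → b ≡ c
  bit-injective {false} {false} _   = ≡.refl
  bit-injective {false} {true}  0≈1 = contradiction 0≈1 0≉1
  bit-injective {true}  {false} 1≈0 = contradiction (sym 1≈0) 0≉1
  bit-injective {true}  {true}  _   = ≡.refl

  bit-sum : ∀ {n} (f : Fin n → Bool) → bit (⊕.sum f) ≈ sum (bit ∘ f)
  bit-sum {zero}  f = refl
  bit-sum {suc n} f = trans (bit-xor (f Fin.zero) _) (+-congˡ (bit-sum (f ∘ Fin.suc)))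

  -- `tr` only tests whether the trace is 1; a negative answer means 0 because the trace takes no
  -- other values.
  tr≈ : ∀ x → bit (tr F x) ≈ T x
  tr≈ x with T x ≟ 1#
  ... | yes T≈1 = sym T≈1
  ... | no  T≉1 with T≈0⊎T≈1 x
  ...   | inj₁ T≈0 = sym T≈0
  ...   | inj₂ T≈1 = contradiction T≈1 T≉1

  tr-cong : ∀ {x y} → x ≈ y → tr F x ≡ tr F y
  tr-cong x≈y = bit-injective (trans (tr≈ _) (trans (T-cong x≈y) (sym (tr≈ _))))

  tr-+ : ∀ x y → tr F (x + y) ≡ tr F x xor tr F y
  tr-+ x y = bit-injective (begin
    bit (tr F (x + y))             ≈⟨ tr≈ _ ⟩
    T (x + y)                      ≈⟨ T-+ x y ⟩
    T x + T y                      ≈⟨ +-cong (tr≈ x) (tr≈ y) ⟨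
    bit (tr F x) + bit (tr F y)    ≈⟨ bit-xor _ _ ⟨
    bit (tr F x xor tr F y)        ∎)

  -- `dot` takes an enumeration, so induction on its length needs one of the tail. Its set is taken
  -- to be whatever the tail lists, which makes surjectivity immediate.
  tail-enumeration : ∀ {k} {D : Mat F k → Set} {N} (E : Enumeration F D (suc N)) →
    Enumeration F (λ M → Σ (Fin N) (λ j → _≈M_ F (Enumeration.g E (Fin.suc j)) M)) N
  tail-enumeration E = record
    { g     = g ∘ Fin.suc
    ; g∈D   = λ j → j , λ _ _ → refl
    ; g-inj = λ i j eq → Finₚ.suc-injective (g-inj _ _ eq)
    ; g-sur = λ M M∈ → M∈
    }
    where open Enumeration E

  -- The local fold inside dot ignores the enumeration, so Agda identifies its instances for E and for its tail.
  dot≡⊕ : ∀ {k} {D : Mat F k → Set} {N} (E : Enumeration F D N) u v →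
          dot F E u v ≡ ⊕.sum (λ j → u j ∧ v j)
  dot≡⊕ {N = zero}  E u v = ≡.refl
  dot≡⊕ {N = suc N} E u v = ≡.cong ((u Fin.zero ∧ v Fin.zero) xor_)
    (dot≡⊕ (tail-enumeration E) (u ∘ Fin.suc) (v ∘ Fin.suc))

  module _ {k : ℕ} {D : Mat F k → Set} {N : ℕ} (E : Enumeration F D N) where
    open Enumeration E

    _⊞_ : (Fin N → Bool) → (Fin N → Bool) → Fin N → Bool
    (u ⊞ v) j = u j xor v j

    t : Fin N → Carrier
    t j = MTr F (g j)

    dot-xorˡ : ∀ u v w → dot F E (u ⊞ v) w ≡ dot F E u w xor dot F E v w
    dot-xorˡ u v w rewrite dot≡⊕ E (u ⊞ v) w | dot≡⊕ E u w | dot≡⊕ E v w =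
      ≡.trans (⊕.sum-cong-≗ {N} (λ j → ∧-distribʳ-xor (w j) (u j) (v j)))
              (⊕.∑-distrib-+ (λ j → u j ∧ w j) (λ j → v j ∧ w j))

    dot-xorʳ : ∀ u v w → dot F E u (v ⊞ w) ≡ dot F E u v xor dot F E u w
    dot-xorʳ u v w rewrite dot≡⊕ E u (v ⊞ w) | dot≡⊕ E u v | dot≡⊕ E u w =
      ≡.trans (⊕.sum-cong-≗ {N} (λ j → ∧-distribˡ-xor (u j) (v j) (w j)))
              (⊕.∑-distrib-+ (λ j → u j ∧ v j) (λ j → u j ∧ w j))

    dot-basis : ∀ i v → dot F E (λ j → does (j Fin.≟ i)) v ≡ v i
    dot-basis i v = ≡.trans (dot≡⊕ E (λ j → does (j Fin.≟ i)) v)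
      (≡.trans (sum-single F₂.+-commutativeMonoid (λ j → does (j Fin.≟ i) ∧ v j) i off) on)
      where
      off : ∀ j → j ≢ i → does (j Fin.≟ i) ∧ v j ≡ false
      off j j≢i with j Fin.≟ i
      ... | yes j≡i = contradiction j≡i j≢i
      ... | no  _   = ≡.refl
      on : does (i Fin.≟ i) ∧ v i ≡ v i
      on with i Fin.≟ i
      ... | yes _   = ≡.refl
      ... | no  i≢i = contradiction ≡.refl i≢i

    -- Additivity of the trace gathers the inner product into one trace of a times the syndrome of
    -- u. Both inclusions rest on this: a zero syndrome kills all pairings, and if all pairings
    -- vanish, nondegeneracy kills the syndrome.
    bit-dot-cw : ∀ u a → bit (dot F E u (cw F E a)) ≈ T (a * sum (λ j → bit (u j) * t j))
    bit-dot-cw u a = begin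
      bit (dot F E u (cw F E a))                    ≡⟨ ≡.cong bit (dot≡⊕ E u (cw F E a)) ⟩
      bit (⊕.sum (λ j → u j ∧ tr F (a * t j)))      ≈⟨ bit-sum (λ j → u j ∧ tr F (a * t j)) ⟩
      sum (λ j → bit (u j ∧ tr F (a * t j)))        ≈⟨ sum-cong-≋ {N} (λ j → term (u j) (t j)) ⟩
      sum (λ j → T (a * (bit (u j) * t j)))         ≈⟨ T-sum (λ j → a * (bit (u j) * t j)) ⟨
      T (sum (λ j → a * (bit (u j) * t j)))         ≈⟨ T-cong (*-distribˡ-sum a (λ j → bit (u j) * t j)) ⟨
      T (a * sum (λ j → bit (u j) * t j))           ∎
      where
      term : ∀ b x → bit (b ∧ tr F (a * x)) ≈ T (a * (bit b * x))
      term true  x = trans (tr≈ _) (T-cong (*-congˡ (sym (*-identityˡ x))))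
      term false x = sym (trans (T-cong (trans (*-congˡ (zeroˡ x)) (zeroʳ a))) T-0)

    syndrome≈ : (u : Fin N → Bool) → Σ[<_]_ F N (λ j → if u j then t j else 0#) ≈ sum (λ j → bit (u j) * t j)
    syndrome≈ u = trans (reflexive (Σ≡sum N (λ j → if u j then t j else 0#))) 
      (sum-cong-≋ {N} (λ j → term (u j) (t j)))
      where
      term : ∀ b x → (if b then x else 0#) ≈ bit b * x
      term true  x = sym (*-identityˡ x)
      term false x = sym (zeroˡ x)

    cw∈C⊥ : ∀ a → InC⊥ F E (cw F E a)
    cw∈C⊥ a u u∈C = bit-injective (begin
      bit (dot F E u (cw F E a))             ≈⟨ bit-dot-cw u a ⟩
      T (a * sum (λ j → bit (u j) * t j))    ≈⟨ T-cong (trans (*-congˡ (trans (sym (syndrome≈ u)) u∈C)) (zeroʳ a)) ⟩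
      T 0#                                   ≈⟨ T-0 ⟩
      0#                                     ∎)

    cw-+ : ∀ a b j → cw F E (a + b) j ≡ cw F E a j xor cw F E b j
    cw-+ a b j = ≡.trans (tr-cong (distribʳ (t j) a b)) (tr-+ (a * t j) (b * t j))

    cw-0 : ∀ j → cw F E 0# j ≡ false
    cw-0 j = bit-injective (trans (tr≈ _) (trans (T-cong (zeroˡ (t j))) T-0))

    -- Fredholm alternative.  If the list grows by a and the separating vector u for v has u·c(a) = 1,
    -- then u must be corrected by the separating vector u′ for v + c(a).
    codeword-or-separated : ∀ as v →
      (∃ λ a → ∀ j → v j ≡ cw F E a j) ⊎
      (∃ λ u → All (λ a → dot F E u (cw F E a) ≡ false) as × dot F E u v ≡ true)
    codeword-or-separated [] v with Finₚ.any? (λ j → v j Bool.≟ true)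
    ... | yes (j , vⱼ) = inj₂ ((λ i → does (i Fin.≟ j)) , [] , ≡.trans (dot-basis j v) vⱼ)
    ... | no  v≢true   = inj₁ (0# , λ j → ≡.trans (Boolₚ.¬-not (λ vⱼ → v≢true (j , vⱼ))) (≡.sym (cw-0 j)))
    codeword-or-separated (a ∷ as) v with codeword-or-separated as v
    ... | inj₁ v∈W = inj₁ v∈W
    ... | inj₂ (u , u⊥as , u·v) with dot F E u (cw F E a) in u·a
    ...   | false = inj₂ (u , u·a ∷ u⊥as , u·v)
    ...   | true with codeword-or-separated as (v ⊞ cw F E a)
    ...     | inj₁ (b , v+a≡b) = inj₁ (b + a , λ j →
      ≡.trans (≡.sym (xor-cancelʳ (v j) (cw F E a j)))
        (≡.trans (≡.cong (_xor cw F E a j) (v+a≡b j)) (≡.sym (cw-+ b a j))))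
      where
      xor-cancelʳ : ∀ b c → (b xor c) xor c ≡ b
      xor-cancelʳ b c = ≡.trans (xor-assoc b c c) (≡.trans (≡.cong (b xor_) (xor-same c)) (xor-identityʳ b))
    ...     | inj₂ (u′ , u′⊥as , u′·[v+a]) with dot F E u′ (cw F E a) in u′·a | dot-xorʳ u′ v (cw F E a)
    ...       | false | eq = inj₂ (u′ , u′·a ∷ u′⊥as ,
      ≡.trans (≡.sym (≡.trans eq (xor-identityʳ _))) u′·[v+a])
    -- Both words pair to 1 with c(a), so their sum pairs to 0 with it; and u′·v = 1 + 1 = 0 leaves
    -- u·v = 1.
    ...       | true  | eq = inj₂ (u ⊞ u′
      , ≡.trans (dot-xorˡ u u′ _) (≡.cong₂ _xor_ u·a u′·a)
        ∷ All.zipWith (λ (p , p′) → ≡.trans (dot-xorˡ u u′ _) (≡.cong₂ _xor_ p p′)) (u⊥as , u′⊥as)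
      , ≡.trans (dot-xorˡ u u′ v) (≡.cong₂ _xor_ u·v u′·v))
      where
      u′·v : dot F E u′ v ≡ false
      u′·v = Boolₚ.not-injective (≡.trans (≡.sym (Boolₚ.xor-comm (dot F E u′ v) true)) (≡.trans (≡.sym eq) u′·[v+a]))

    -- With all field elements listed, a separating u is orthogonal to every codeword. Its syndrome
    -- is then 0, so u lies in the code, and u·v = 1 contradicts v being in the dual.
    C⊥⊆cw : ∀ v → InC⊥ F E v → ∃ λ a → ∀ j → v j ≡ cw F E a j
    C⊥⊆cw v v∈C⊥ with codeword-or-separated (tabulate enum) v
    ... | inj₁ v∈W               = v∈W
    ... | inj₂ (u , u⊥W , u·v) = contradiction (≡.trans (≡.sym u·v) (v∈C⊥ u u∈C)) λ ()
      where
      S = sum (λ j → bit (u j) * t j)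

      Tx≈0 : ∀ x → T (S * x) ≈ 0#
      Tx≈0 x = begin
        T (S * x)                                   ≈⟨ T-cong (trans (*-congˡ (sym (enum-index x))) (*-comm S _)) ⟩
        T (enum (index x) * S)                      ≈⟨ bit-dot-cw u (enum (index x)) ⟨
        bit (dot F E u (cw F E (enum (index x))))   ≡⟨ ≡.cong bit (tabulate⁻ u⊥W (index x)) ⟩
        0#                                          ∎

      u∈C : InC F E u
      u∈C = trans (syndrome≈ u) (T-nondegenerate Tx≈0)

    -- Of the four clauses only injectivity depends on which traces occur, and additivity reduces it
    -- to a trivial kernel.
    isF2Iso : (∀ {a} → (∀ j → T (a * t j) ≈ 0#) → a ≈ 0#) → IsF2Iso F E
    isF2Iso nondegenerate = cw∈C⊥ , cw-+ , injective , C⊥⊆cw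
      where
      injective : ∀ a b → (∀ j → cw F E a j ≡ cw F E b j) → a ≈ b
      injective a b a≡b = x+y≈0⇒x≈y (nondegenerate λ j → begin
        T ((a + b) * t j)                ≈⟨ tr≈ _ ⟨
        bit (cw F E (a + b) j)           ≡⟨ ≡.cong bit (cw-+ a b j) ⟩
        bit (cw F E a j xor cw F E b j)  ≡⟨ ≡.cong (λ c → bit (c xor cw F E b j)) (a≡b j) ⟩
        bit (cw F E b j xor cw F E b j)  ≡⟨ ≡.cong bit (xor-same (cw F E b j)) ⟩
        0#                               ∎)

    nondegenerate-on-D : ∀ {a} → (∀ j → T (a * t j) ≈ 0#) → ∀ {M} → D M → T (a * MTr F M) ≈ 0#
    nondegenerate-on-D {a} Ta≈0 {M} M∈D with g-sur M M∈D
    ... | j , gⱼ≈M = trans (T-cong (*-congˡ (begin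
      MTr F M                      ≡⟨ Σ≡sum k (λ i → M i i) ⟩
      sum (λ i → M i i)            ≈⟨ sum-cong-≋ {k} (λ i → sym (gⱼ≈M i i)) ⟩
      sum (λ i → g j i i)          ≡⟨ Σ≡sum k (λ i → g j i i) ⟨
      t j                          ∎))) (Ta≈0 j)

-- Block matrices and traces on the double cosets

↑-elim : ∀ {n} (P : Fin (n ℕ.+ n) → Set) → (∀ i → P (i ↑ˡ n)) → (∀ i → P (n ↑ʳ i)) → ∀ i → P i
↑-elim {n} P l r i = ≡.subst P (Finₚ.join-splitAt n n i) (join-elim (splitAt n i))
  where
  join-elim : ∀ s → P (Fin.join n n s)
  join-elim (inj₁ i) = l i
  join-elim (inj₂ i) = r i

module Traces {m : ℕ} (F : FiniteField (suc m)) where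
  open FiniteField F
  open FieldTheory F
  open Trace F
  open import Algebra.Properties.Semiring.Sum semiring
  open import Algebra.Solver.Ring.NaturalCoefficients.Default commutativeSemiring
    using (solve; _:=_; _:+_; _:*_; con)
  open import Relation.Binary.Reasoning.Setoid setoid

  infixl 7 _⊗_
  infixl 6 _⊕_
  infix  4 _≃_

  _⊗_ _⊕_ : ∀ {n} → Mat F n → Mat F n → Mat F n
  _⊗_ = _*M_ F
  (M ⊕ N) i j = M i j + N i j

  I O : ∀ {n} → Mat F n
  I = idM F
  O = zeroM F

  -- As a record, so that the two matrices can be inferred.
  record _≃_ {n} (M N : Mat F n) : Set where
    constructor entrywise
    field at : _≈M_ F M N
  open _≃_ public

  ≃-refl : ∀ {n} {M : Mat F n} → M ≃ M
  ≃-refl .at _ _ = refl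

  ≃-sym : ∀ {n} {M N : Mat F n} → M ≃ N → N ≃ M
  ≃-sym M≃N .at i j = sym (at M≃N i j)

  ≃-trans : ∀ {n} {L M N : Mat F n} → L ≃ M → M ≃ N → L ≃ N
  ≃-trans L≃M M≃N .at i j = trans (at L≃M i j) (at M≃N i j)

  ⊕-cong : ∀ {n} {M M′ N N′ : Mat F n} → M ≃ M′ → N ≃ N′ → M ⊕ N ≃ M′ ⊕ N′
  ⊕-cong M≃ N≃ .at i j = +-cong (at M≃ i j) (at N≃ i j)

  ⊕-identityˡ : ∀ {n} (M : Mat F n) → O ⊕ M ≃ M
  ⊕-identityˡ M .at i j = +-identityˡ _

  ⊕-identityʳ : ∀ {n} (M : Mat F n) → M ⊕ O ≃ M
  ⊕-identityʳ M .at i j = +-identityʳ _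

  ⊗≈ : ∀ {n} (M N : Mat F n) i j → (M ⊗ N) i j ≈ sum (λ k → M i k * N k j)
  ⊗≈ {n} M N i j = reflexive (Σ≡sum n (λ k → M i k * N k j))

  Tr≈ : ∀ {n} (M : Mat F n) → MTr F M ≈ sum (λ i → M i i)
  Tr≈ {n} M = reflexive (Σ≡sum n (λ i → M i i))

  Tr-cong : ∀ {n} {M N : Mat F n} → M ≃ N → MTr F M ≈ MTr F N
  Tr-cong {n} {M} {N} M≃N = trans (Tr≈ M) (trans (sum-cong-≋ {n} (λ i → at M≃N i i)) (sym (Tr≈ N)))

  Tr-⊕ : ∀ {n} (M N : Mat F n) → MTr F (M ⊕ N) ≈ MTr F M + MTr F N
  Tr-⊕ M N = trans (Tr≈ (M ⊕ N)) (trans (∑-distrib-+ (λ i → M i i) (λ i → N i i))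
    (sym (+-cong (Tr≈ M) (Tr≈ N))))

  ⊗-cong : ∀ {n} {M M′ N N′ : Mat F n} → M ≃ M′ → N ≃ N′ → M ⊗ N ≃ M′ ⊗ N′
  ⊗-cong {n} {M} {M′} {N} {N′} M≃ N≃ .at i j = trans (⊗≈ M N i j)
    (trans (sum-cong-≋ {n} (λ k → *-cong (at M≃ i k) (at N≃ k j))) (sym (⊗≈ M′ N′ i j)))

  I-diagonal : ∀ {n} (i : Fin n) → I i i ≈ 1#
  I-diagonal i with i Fin.≟ i
  ... | yes _   = refl
  ... | no  i≢i = contradiction ≡.refl i≢i

  I-off : ∀ {n} {i j : Fin n} → i ≢ j → I i j ≈ 0#
  I-off {i = i} {j} i≢j with i Fin.≟ j
  ... | yes i≡j = contradiction i≡j i≢j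
  ... | no  _   = refl

  transpose-I : ∀ {n} → transpose F (I {n}) ≃ I
  transpose-I .at i j with i Fin.≟ j
  ... | yes ≡.refl = I-diagonal i
  ... | no  i≢j    = I-off (i≢j ∘ ≡.sym)

  ⊗-identityˡ : ∀ {n} (M : Mat F n) → I ⊗ M ≃ M
  ⊗-identityˡ M .at i j = trans (⊗≈ I M i j) (trans
    (sum-single +-commutativeMonoid (λ k → I i k * M k j) i
      (λ k k≢i → trans (*-congʳ (I-off (k≢i ∘ ≡.sym))) (zeroˡ _)))
    (trans (*-congʳ (I-diagonal i)) (*-identityˡ _)))

  ⊗-identityʳ : ∀ {n} (M : Mat F n) → M ⊗ I ≃ M
  ⊗-identityʳ M .at i j = trans (⊗≈ M I i j) (trans
    (sum-single +-commutativeMonoid (λ k → M i k * I k j) j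
      (λ k k≢j → trans (*-congˡ (I-off k≢j)) (zeroʳ _)))
    (trans (*-congˡ (I-diagonal j)) (*-identityʳ _)))

  ⊗-zeroˡ : ∀ {n} (M : Mat F n) → O ⊗ M ≃ O
  ⊗-zeroˡ {n} M .at i j = trans (⊗≈ O M i j)
    (trans (sum-cong-≋ {n} (λ k → zeroˡ (M k j))) (sum-replicate-zero n))

  ⊗-zeroʳ : ∀ {n} (M : Mat F n) → M ⊗ O ≃ O
  ⊗-zeroʳ {n} M .at i j = trans (⊗≈ M O i j)
    (trans (sum-cong-≋ {n} (λ k → zeroʳ (M i k))) (sum-replicate-zero n))

  module _ {n} (A B C D : Mat F n) where
    block-ˡˡ : ∀ i j → block F A B C D (i ↑ˡ n) (j ↑ˡ n) ≡ A i j
    block-ˡˡ i j rewrite Finₚ.splitAt-↑ˡ n i n | Finₚ.splitAt-↑ˡ n j n = ≡.refl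

    block-ˡʳ : ∀ i j → block F A B C D (i ↑ˡ n) (n ↑ʳ j) ≡ B i j
    block-ˡʳ i j rewrite Finₚ.splitAt-↑ˡ n i n | Finₚ.splitAt-↑ʳ n n j = ≡.refl

    block-ʳˡ : ∀ i j → block F A B C D (n ↑ʳ i) (j ↑ˡ n) ≡ C i j
    block-ʳˡ i j rewrite Finₚ.splitAt-↑ʳ n n i | Finₚ.splitAt-↑ˡ n j n = ≡.refl

    block-ʳʳ : ∀ i j → block F A B C D (n ↑ʳ i) (n ↑ʳ j) ≡ D i j
    block-ʳʳ i j rewrite Finₚ.splitAt-↑ʳ n n i | Finₚ.splitAt-↑ʳ n n j = ≡.refl

    block-unique : ∀ {X : Mat F (n ℕ.+ n)} →
      (∀ i j → X (i ↑ˡ n) (j ↑ˡ n) ≈ A i j) → (∀ i j → X (i ↑ˡ n) (n ↑ʳ j) ≈ B i j) →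
      (∀ i j → X (n ↑ʳ i) (j ↑ˡ n) ≈ C i j) → (∀ i j → X (n ↑ʳ i) (n ↑ʳ j) ≈ D i j) →
      X ≃ block F A B C D
    block-unique {X} a b c d .at = ↑-elim (λ i → ∀ j → X i j ≈ block F A B C D i j)
      (λ i → ↑-elim (λ j → X (i ↑ˡ n) j ≈ block F A B C D (i ↑ˡ n) j)
        (λ j → trans (a i j) (reflexive (≡.sym (block-ˡˡ i j))))
        (λ j → trans (b i j) (reflexive (≡.sym (block-ˡʳ i j)))))
      (λ i → ↑-elim (λ j → X (n ↑ʳ i) j ≈ block F A B C D (n ↑ʳ i) j)
        (λ j → trans (c i j) (reflexive (≡.sym (block-ʳˡ i j))))
        (λ j → trans (d i j) (reflexive (≡.sym (block-ʳʳ i j)))))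

    Tr-block : MTr F (block F A B C D) ≈ MTr F A + MTr F D
    Tr-block = trans (Tr≈ (block F A B C D)) (trans (sum-↑ +-commutativeMonoid n _) (+-cong
      (trans (sum-cong-≋ {n} (λ i → reflexive (block-ˡˡ i i))) (sym (Tr≈ A)))
      (trans (sum-cong-≋ {n} (λ i → reflexive (block-ʳʳ i i))) (sym (Tr≈ D)))))

    module _ (A′ B′ C′ D′ : Mat F n) where
      private
        X X′ : Mat F (n ℕ.+ n)
        X  = block F A B C D
        X′ = block F A′ B′ C′ D′

      -- One computation serves all four quadrants: `L`, `R` hold the halves of row `p`, and `L′`,
      -- `R′` those of column `q`.
      row×column : ∀ (L R L′ R′ : Mat F n) i j {p q} →
        (∀ k → X p (k ↑ˡ n) ≡ L i k) → (∀ k → X p (n ↑ʳ k) ≡ R i k) →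
        (∀ k → X′ (k ↑ˡ n) q ≡ L′ k j) → (∀ k → X′ (n ↑ʳ k) q ≡ R′ k j) →
        (X ⊗ X′) p q ≈ (L ⊗ L′ ⊕ R ⊗ R′) i j
      row×column L R L′ R′ i j {p} {q} l r l′ r′ = trans (⊗≈ X X′ p q)
        (trans (sum-↑ +-commutativeMonoid n _) (+-cong
          (trans (sum-cong-≋ {n} (λ k → *-cong (reflexive (l k)) (reflexive (l′ k)))) (sym (⊗≈ L L′ i j)))
          (trans (sum-cong-≋ {n} (λ k → *-cong (reflexive (r k)) (reflexive (r′ k)))) (sym (⊗≈ R R′ i j)))))

  block-⊗ : ∀ {n} (A B C D A′ B′ C′ D′ : Mat F n) →
    block F A B C D ⊗ block F A′ B′ C′ D′ ≃
    block F (A ⊗ A′ ⊕ B ⊗ C′) (A ⊗ B′ ⊕ B ⊗ D′) (C ⊗ A′ ⊕ D ⊗ C′) (C ⊗ B′ ⊕ D ⊗ D′)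
  block-⊗ A B C D A′ B′ C′ D′ = block-unique _ _ _ _
    (λ i j → rc A B A′ C′ i j (ˡˡ i) (ˡʳ i) (λ k → ˡˡ′ k j) (λ k → ʳˡ′ k j))
    (λ i j → rc A B B′ D′ i j (ˡˡ i) (ˡʳ i) (λ k → ˡʳ′ k j) (λ k → ʳʳ′ k j))
    (λ i j → rc C D A′ C′ i j (ʳˡ i) (ʳʳ i) (λ k → ˡˡ′ k j) (λ k → ʳˡ′ k j))
    (λ i j → rc C D B′ D′ i j (ʳˡ i) (ʳʳ i) (λ k → ˡʳ′ k j) (λ k → ʳʳ′ k j))
    where
    rc  = row×column A B C D A′ B′ C′ D′
    ˡˡ  = block-ˡˡ A B C D
    ˡʳ  = block-ˡʳ A B C D
    ʳˡ  = block-ʳˡ A B C D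
    ʳʳ  = block-ʳʳ A B C D
    ˡˡ′ = block-ˡˡ A′ B′ C′ D′
    ˡʳ′ = block-ˡʳ A′ B′ C′ D′
    ʳˡ′ = block-ʳˡ A′ B′ C′ D′
    ʳʳ′ = block-ʳʳ A′ B′ C′ D′

  block-cong : ∀ {n} {A B C D A′ B′ C′ D′ : Mat F n} → A ≃ A′ → B ≃ B′ → C ≃ C′ → D ≃ D′ →
    block F A B C D ≃ block F A′ B′ C′ D′
  block-cong {n} {A} {B} {C} {D} a b c d = block-unique _ _ _ _
    (λ i j → trans (reflexive (block-ˡˡ A B C D i j)) (at a i j))
    (λ i j → trans (reflexive (block-ˡʳ A B C D i j)) (at b i j))
    (λ i j → trans (reflexive (block-ʳˡ A B C D i j)) (at c i j))
    (λ i j → trans (reflexive (block-ʳʳ A B C D i j)) (at d i j))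

  block-I : ∀ {n} → I ≃ block F (I {n}) O O I
  block-I {n} = block-unique I O O I
    (I-injection (_↑ˡ n) (λ {i} {j} → Finₚ.↑ˡ-injective n i j))
    (λ i j → I-off (ˡ≢ʳ i j))
    (λ i j → I-off (ˡ≢ʳ j i ∘ ≡.sym))
    (I-injection (n ↑ʳ_) (λ {i} {j} → Finₚ.↑ʳ-injective n i j))
    where
    I-injection : ∀ {k l} (f : Fin l → Fin k) → (∀ {i j} → f i ≡ f j → i ≡ j) → ∀ i j → I (f i) (f j) ≈ I i j
    I-injection f inj i j with i Fin.≟ j
    ... | yes ≡.refl = I-diagonal (f i)
    ... | no  i≢j    = I-off (i≢j ∘ inj)
    ˡ≢ʳ : ∀ i j → i ↑ˡ n ≢ n ↑ʳ j
    ˡ≢ʳ i j eq with ≡.trans (≡.sym (Finₚ.splitAt-↑ˡ n i n)) (≡.trans (≡.cong (splitAt n) eq) (Finₚ.splitAt-↑ʳ n n j))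
    ... | ()

  -- The complementary projections diag(1ₛ, 0) and diag(0, 1ₙ₋ₛ), with the nested tests of `σ` so
  -- that its blocks agree with them by computation.
  swapped fixed : ∀ n s → Mat F n
  swapped n s a b = if does (a Fin.≟ b) then (if does (toℕ a ℕ.<? s) then 1# else 0#) else 0#
  fixed   n s a b = if does (a Fin.≟ b) then (if does (toℕ a ℕ.<? s) then 0# else 1#) else 0#

  σ≃ : ∀ n s → σ F n s ≃ block F (fixed n s) (swapped n s) (swapped n s) (fixed n s)
  σ≃ n s .at i j with splitAt n i | splitAt n j
  ... | inj₁ _ | inj₁ _ = refl
  ... | inj₁ _ | inj₂ _ = refl
  ... | inj₂ _ | inj₁ _ = refl
  ... | inj₂ _ | inj₂ _ = refl

  module _ (n s : ℕ) (A A⁻ B : Mat F n) (AA⁻ : A ⊗ A⁻ ≃ I) (A⁻A : A⁻ ⊗ A ≃ I)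
           (B-sym : transpose F B ≃ B) where
    private
      S  = swapped n s
      S′ = fixed n s
      A⁻ᵗ = transpose F A⁻

      p : Mat F (n ℕ.+ n)
      p = block F A O O A⁻ᵗ ⊗ block F I B O I

      1₂ : Mat F (n ℕ.+ n)
      1₂ = block F {n} I O O I

      -- The right factor is the identity: by conjugation invariance of the trace, P σ already has
      -- all the traces of P σ P. The product form is the one that membership in P asks for.
      e : Mat F (n ℕ.+ n)
      e = 1₂ ⊗ 1₂

      e≃I : e ≃ I
      e≃I = ≃-trans (⊗-cong (≃-sym (block-I {n})) (≃-refl {M = 1₂}))
        (≃-trans (⊗-identityˡ 1₂) (≃-sym (block-I {n})))

      p≃ : p ≃ block F A (A ⊗ B) O A⁻ᵗ
      p≃ = ≃-trans (block-⊗ A O O A⁻ᵗ I B O I) (block-cong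
        (≃-trans (⊕-cong (⊗-identityʳ A) (⊗-zeroˡ O)) (⊕-identityʳ A))
        (≃-trans (⊕-cong ≃-refl (⊗-zeroˡ I)) (⊕-identityʳ (A ⊗ B)))
        (≃-trans (⊕-cong (⊗-zeroˡ I) (⊗-zeroʳ A⁻ᵗ)) (⊕-identityʳ O))
        (≃-trans (⊕-cong (⊗-zeroˡ B) (⊗-identityʳ A⁻ᵗ)) (⊕-identityˡ A⁻ᵗ)))

    double-coset-element : Mat F (n ℕ.+ n)
    double-coset-element = (p ⊗ σ F n s) ⊗ e

    double-coset-element∈ : InDC F n s double-coset-element
    double-coset-element∈ = p , e , (A , A⁻ , B , at AA⁻ , at A⁻A , at B-sym , λ _ _ → refl)
      , (I , I , O , at (⊗-identityˡ I) , at (⊗-identityˡ I) , (λ _ _ → refl)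
        , at (⊗-cong (block-cong {n} {I} {O} {O} ≃-refl ≃-refl ≃-refl (≃-sym transpose-I))
                     (≃-refl {M = 1₂})))
      , λ _ _ → refl

    -- Multiplying (A AB; 0 ᵗA⁻¹) by σ gives the diagonal blocks A S′ + A B S and ᵗA⁻¹ S′, where S,
    -- S′ are the swapped and fixed projections.
    double-coset-trace : MTr F double-coset-element ≈
      MTr F (A ⊗ S′) + MTr F (A ⊗ B ⊗ S) + MTr F (A⁻ᵗ ⊗ S′)
    double-coset-trace = begin
      MTr F ((p ⊗ σ F n s) ⊗ e)                   ≈⟨ Tr-cong (⊗-cong (⊗-cong p≃ (σ≃ n s)) e≃I) ⟩
      MTr F ((p′ ⊗ σ′) ⊗ I)                       ≈⟨ Tr-cong (⊗-identityʳ (p′ ⊗ σ′)) ⟩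
      MTr F (p′ ⊗ σ′)                             ≈⟨ Tr-cong (block-⊗ A (A ⊗ B) O A⁻ᵗ S′ S S S′) ⟩
      MTr F (block F X Y Z W)                     ≈⟨ Tr-block X Y Z W ⟩
      MTr F X + MTr F W                           ≈⟨ +-cong (Tr-⊕ (A ⊗ S′) (A ⊗ B ⊗ S))
        (Tr-cong (≃-trans (⊕-cong (⊗-zeroˡ S) ≃-refl) (⊕-identityˡ (A⁻ᵗ ⊗ S′)))) ⟩
      MTr F (A ⊗ S′) + MTr F (A ⊗ B ⊗ S) + MTr F (A⁻ᵗ ⊗ S′) ∎
      where
      p′ = block F A (A ⊗ B) O A⁻ᵗ
      σ′ = block F S′ S S S′
      X  = A ⊗ S′ ⊕ A ⊗ B ⊗ S
      Y  = A ⊗ S ⊕ A ⊗ B ⊗ S′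
      Z  = O ⊗ S′ ⊕ A⁻ᵗ ⊗ S
      W  = O ⊗ S ⊕ A⁻ᵗ ⊗ S′

  fixed-0 : ∀ n → fixed n 0 ≃ I
  fixed-0 n .at i j = refl

  swapped-0 : ∀ n → swapped n 0 ≃ O
  swapped-0 n .at i j with i Fin.≟ j
  ... | yes _ = refl
  ... | no  _ = refl

  -- σ₀ is the identity, so the traces are those of P.
  DC₀-trace : ∀ {n} (A A⁻ : Mat F n) → A ⊗ A⁻ ≃ I → A⁻ ⊗ A ≃ I →
    ∃ λ M → InDC F n 0 M × MTr F M ≈ MTr F A + MTr F A⁻
  DC₀-trace {n} A A⁻ AA⁻ A⁻A = _ , double-coset-element∈ n 0 A A⁻ O AA⁻ A⁻A ≃-refl , (begin
    _                                            ≈⟨ double-coset-trace n 0 A A⁻ O AA⁻ A⁻A ≃-refl ⟩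
    MTr F (A ⊗ fixed n 0) + MTr F (A ⊗ O ⊗ swapped n 0) + MTr F (transpose F A⁻ ⊗ fixed n 0) ≈⟨ +-cong (+-cong
        (Tr-cong (≃-trans (⊗-cong ≃-refl (fixed-0 n)) (⊗-identityʳ A)))
        (Tr-cong (≃-trans (⊗-cong ≃-refl (swapped-0 n)) (⊗-zeroʳ (A ⊗ O)))))
        (Tr-cong (≃-trans (⊗-cong ≃-refl (fixed-0 n)) (⊗-identityʳ (transpose F A⁻)))) ⟩
    MTr F A + MTr F (O {n}) + MTr F A⁻           ≈⟨ +-congʳ (trans (+-congˡ
                                                      (trans (Tr≈ (O {n})) (sum-replicate-zero n))) (+-identityʳ _)) ⟩
    MTr F A + MTr F A⁻                           ∎)

  corner : ∀ {n} → Carrier → Mat F n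
  corner x Fin.zero Fin.zero = x
  corner x _        _        = 0#

  corner-row : ∀ {n} x (i : Fin (suc n)) k → i ≢ Fin.zero → corner x i k ≈ 0#
  corner-row x Fin.zero    k i≢0 = contradiction ≡.refl i≢0
  corner-row x (Fin.suc i) k i≢0 = refl

  corner-column : ∀ {n} x (k : Fin (suc n)) → k ≢ Fin.zero → corner x Fin.zero k ≈ 0#
  corner-column x Fin.zero    k≢0 = contradiction ≡.refl k≢0
  corner-column x (Fin.suc k) k≢0 = refl

  corner-symmetric : ∀ {n} x → transpose F (corner {n} x) ≃ corner x
  corner-symmetric x .at Fin.zero    Fin.zero    = refl
  corner-symmetric x .at Fin.zero    (Fin.suc _) = refl
  corner-symmetric x .at (Fin.suc _) Fin.zero    = refl
  corner-symmetric x .at (Fin.suc _) (Fin.suc _) = refl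

  Tr-corner : ∀ {n} x (M : Mat F (suc n)) → MTr F (corner x ⊗ M) ≈ x * M Fin.zero Fin.zero
  Tr-corner {n} x M = begin
    MTr F (corner x ⊗ M)                                ≈⟨ Tr≈ (corner x ⊗ M) ⟩
    sum (λ i → (corner x ⊗ M) i i)                      ≈⟨ sum-single +-commutativeMonoid (λ i → (corner x ⊗ M) i i) Fin.zero row ⟩
    (corner x ⊗ M) Fin.zero Fin.zero                    ≈⟨ ⊗≈ (corner x) M Fin.zero Fin.zero ⟩
    sum (λ k → corner x Fin.zero k * M k Fin.zero)      ≈⟨ sum-single +-commutativeMonoid
      (λ k → corner x Fin.zero k * M k Fin.zero) Fin.zero
      (λ k k≢0 → trans (*-congʳ (corner-column x k k≢0)) (zeroˡ _)) ⟩
    x * M Fin.zero Fin.zero                             ∎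
    where
    row : ∀ i → i ≢ Fin.zero → (corner x ⊗ M) i i ≈ 0#
    row i i≢0 = trans (⊗≈ (corner x) M i i) (trans
      (sum-cong-≋ {suc n} (λ k → trans (*-congʳ (corner-row x i k i≢0)) (zeroˡ (M k i))))
      (sum-replicate-zero (suc n)))

  swapped-corner : ∀ n {s} → 0 < s → swapped (suc n) s Fin.zero Fin.zero ≈ 1#
  swapped-corner n (s≤s _) = refl

  -- For s > 0, the elements with A = 1 have trace Tr(B · diag(1ₛ, 0)), which is already arbitrary.
  DCₛ-trace : ∀ {n s} → 0 < s → ∀ x → ∃ λ M → InDC F (suc n) s M × MTr F M ≈ x
  DCₛ-trace {n} {s} 0<s x = _ , double-coset-element∈ (suc n) s I I B II II B-sym , (begin
    _                                                      ≈⟨ double-coset-trace (suc n) s I I B II II B-sym ⟩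
    MTr F (I ⊗ S′) + MTr F (I ⊗ B ⊗ S) + MTr F (transpose F I ⊗ S′) ≈⟨ +-cong (+-congˡ (Tr-cong
        (⊗-cong {N = S} (⊗-identityˡ B) ≃-refl))) (Tr-cong (⊗-cong {N = S′} (transpose-I {suc n}) ≃-refl)) ⟩
    -- The fixed coordinates contribute the same trace in the upper and the lower half, so they
    -- cancel in characteristic 2.
    MTr F (I ⊗ S′) + MTr F (B ⊗ S) + MTr F (I ⊗ S′)        ≈⟨ solve 2 (λ a b → a :+ b :+ a := b :+ (a :+ a)) refl _ _ ⟩
    MTr F (B ⊗ S) + (MTr F (I ⊗ S′) + MTr F (I ⊗ S′))      ≈⟨ +-cong (Tr-corner x S) (x+x≈0 _) ⟩
    x * S Fin.zero Fin.zero + 0#                           ≈⟨ +-identityʳ _ ⟩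
    x * S Fin.zero Fin.zero                                ≈⟨ *-congˡ (swapped-corner n 0<s) ⟩
    x * 1#                                                 ≈⟨ *-identityʳ x ⟩
    x                                                      ∎)
    where
    S  = swapped (suc n) s
    S′ = fixed (suc n) s
    B  = corner x
    B-sym = corner-symmetric {suc n} x
    II : I {suc n} ⊗ I ≃ I
    II = ⊗-identityˡ I

-- Injectivity for s > 0, for n = 1 and for n = 2

module DoubleCosetCodes {m : ℕ} (F : FiniteField (suc m)) where
  open FiniteField F
  open FieldTheory F
  open Trace F
  open Inversion F
  open Code F
  open Traces F
  open import Algebra.Solver.Ring.NaturalCoefficients.Default commutativeSemiring
    using (solve; _:=_; _:+_; _:*_; con)
  open import Relation.Binary.Reasoning.Setoid setoid

  module _ {k N} {D : Mat F k → Set} (E : Enumeration F D N) where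

    all-traces⇒nondegenerate : (∀ x → ∃ λ M → D M × MTr F M ≈ x) →
      ∀ {a} → (∀ j → T (a * t E j) ≈ 0#) → a ≈ 0#
    all-traces⇒nondegenerate trace Ta≈0 = T-nondegenerate λ x → case trace x of λ where
      (M , M∈D , trM≈x) → trans (T-cong (*-congˡ (sym trM≈x))) (nondegenerate-on-D E Ta≈0 M∈D)

  DCₛ-iso : ∀ {n s N} → 0 < s → (E : Enumeration F (InDC F (suc n) s) N) → IsF2Iso F E
  DCₛ-iso 0<s E = isF2Iso E (all-traces⇒nondegenerate E (DCₛ-trace 0<s))

  -- Here x and x⁻¹ give the same trace, so the traces do not exhaust the field and plain
  -- nondegeneracy is not enough.
  DC₁₀-iso : ∀ {N} → 2 ≤ m → (E : Enumeration F (InDC F 1 0) N) → IsF2Iso F E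
  DC₁₀-iso 2≤m E = isF2Iso E λ Ta≈0 → T-inversion-nondegenerate 2≤m λ x x′ xx′≈1 →
    case DC₀-trace (λ _ _ → x) (λ _ _ → x′)
      (entrywise λ { Fin.zero Fin.zero → trans (+-identityʳ _) xx′≈1 })
      (entrywise λ { Fin.zero Fin.zero → trans (+-identityʳ _) (trans (*-comm x′ x) xx′≈1) }) of λ where
      (M , M∈D , trM) → trans
        (T-cong (*-congˡ (sym (trans trM (+-cong (+-identityʳ x) (+-identityʳ x′))))))
        (nondegenerate-on-D E Ta≈0 M∈D)

  -- The matrix A = (y 1; d 0) with inverse (0 e; 1 ye), e = d⁻¹, gives the trace y(1 + e), which is arbitrary if e ≠ 1.
  DC₂₀-trace : ∀ e → ¬ e ≈ 0# → ¬ e + 1# ≈ 0# → ∀ x → ∃ λ M → InDC F 2 0 M × MTr F M ≈ x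
  DC₂₀-trace e e≉0 e+1≉0 x = case DC₀-trace A A⁻ AA⁻ A⁻A of λ where
      (M , M∈D , trM) → M , M∈D , (begin
        MTr F M                                    ≈⟨ trM ⟩
        (y + (0# + 0#)) + (0# + (y * e + 0#))      ≈⟨ solve 2 (λ y e → (y :+ (con 0 :+ con 0)) :+ (con 0 :+ (y :* e :+ con 0))
                                                        := y :* (e :+ con 1)) refl y e ⟩
        y * (e + 1#)                               ≈⟨ *-assoc x w (e + 1#) ⟩
        x * (w * (e + 1#))                         ≈⟨ *-congˡ (trans (*-comm w _) (*-inverseʳ (e + 1#) e+1≉0)) ⟩
        x * 1#                                     ≈⟨ *-identityʳ x ⟩
        x                                          ∎)
    where
    d = e ⁻¹[ e≉0 ]
    w = (e + 1#) ⁻¹[ e+1≉0 ]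
    y = x * w

    ed≈1 : e * d ≈ 1#
    ed≈1 = *-inverseʳ e e≉0

    A A⁻ : Mat F 2
    A Fin.zero    Fin.zero    = y
    A Fin.zero    (Fin.suc _) = 1#
    A (Fin.suc _) Fin.zero    = d
    A (Fin.suc _) (Fin.suc _) = 0#
    A⁻ Fin.zero    Fin.zero    = 0#
    A⁻ Fin.zero    (Fin.suc _) = e
    A⁻ (Fin.suc _) Fin.zero    = 1#
    A⁻ (Fin.suc _) (Fin.suc _) = y * e

    AA⁻ : A ⊗ A⁻ ≃ I
    AA⁻ .at Fin.zero Fin.zero =
      solve 1 (λ y → y :* con 0 :+ (con 1 :* con 1 :+ con 0) := con 1) refl y
    AA⁻ .at Fin.zero (Fin.suc Fin.zero) = trans
      (solve 2 (λ y e → y :* e :+ (con 1 :* (y :* e) :+ con 0) := y :* e :+ y :* e) refl y e) (x+x≈0 _)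
    AA⁻ .at (Fin.suc Fin.zero) Fin.zero =
      solve 1 (λ d → d :* con 0 :+ (con 0 :* con 1 :+ con 0) := con 0) refl d
    AA⁻ .at (Fin.suc Fin.zero) (Fin.suc Fin.zero) = trans
      (solve 3 (λ d e y → d :* e :+ (con 0 :* (y :* e) :+ con 0) := e :* d) refl d e y) ed≈1

    A⁻A : A⁻ ⊗ A ≃ I
    A⁻A .at Fin.zero Fin.zero = trans
      (solve 3 (λ d e y → con 0 :* y :+ (e :* d :+ con 0) := e :* d) refl d e y) ed≈1
    A⁻A .at Fin.zero (Fin.suc Fin.zero) =
      solve 1 (λ e → con 0 :* con 1 :+ (e :* con 0 :+ con 0) := con 0) refl e
    A⁻A .at (Fin.suc Fin.zero) Fin.zero = begin
      1# * y + (y * e * d + 0#)   ≈⟨ solve 3 (λ d e y → con 1 :* y :+ (y :* e :* d :+ con 0) := y :+ y :* (e :* d)) refl d e y ⟩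
      y + y * (e * d)             ≈⟨ +-congˡ (trans (*-congˡ ed≈1) (*-identityʳ y)) ⟩
      y + y                       ≈⟨ x+x≈0 y ⟩
      0#                          ∎
    A⁻A .at (Fin.suc Fin.zero) (Fin.suc Fin.zero) =
      solve 2 (λ y e → con 1 :* con 1 :+ (y :* e :* con 0 :+ con 0) := con 1) refl y e

  -- No parameter e outside {0, 1} has to be exhibited: for a ≠ 0 any such e would give a
  -- contradiction, so every nonzero e would equal 1.
  DC₂₀-iso : ∀ {N} → 1 ≤ m → (E : Enumeration F (InDC F 2 0) N) → IsF2Iso F E
  DC₂₀-iso 1≤m E = isF2Iso E nondegenerate
    where
    nondegenerate : ∀ {a} → (∀ j → T (a * t E j) ≈ 0#) → a ≈ 0#
    nondegenerate {a} Ta≈0 with a ≟ 0#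
    ... | yes a≈0 = a≈0
    ... | no  a≉0 = contradiction only-1 (x+1-nonvanishing 1≤m)
      where
      only-1 : ∀ e → ¬ e ≈ 0# → e + 1# ≈ 0#
      only-1 e e≉0 with (e + 1#) ≟ 0#
      ... | yes e+1≈0 = e+1≈0
      ... | no  e+1≉0 = contradiction (all-traces⇒nondegenerate E (DC₂₀-trace e e≉0 e+1≉0) Ta≈0) a≉0

-- This excludes r = 0, so that the exponent can be written `suc m` and q/2 is the natural number
-- 2^m.
order-1-absurd : FiniteField 0 → ⊥
order-1-absurd F = 0≉1 (trans (sym (proj₂ (enum-surj 0#)))
  (trans (reflexive (≡.cong enum (all-equal (proj₁ (enum-surj 0#)) (proj₁ (enum-surj 1#))))) (proj₂ (enum-surj 1#))))
  where
  open FiniteField F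
  all-equal : (i j : Fin 1) → i ≡ j
  all-equal Fin.zero Fin.zero = ≡.refl

8≤2^[1+m]⇒2≤m : ∀ {m} → 8 ≤ 2 ℕ.^ suc m → 2 ≤ m
8≤2^[1+m]⇒2≤m {zero}        (s≤s (s≤s ()))
8≤2^[1+m]⇒2≤m {suc zero}    (s≤s (s≤s (s≤s (s≤s ()))))
8≤2^[1+m]⇒2≤m {suc (suc m)} _ = s≤s (s≤s z≤n)

4≤2^[1+m]⇒1≤m : ∀ {m} → 4 ≤ 2 ℕ.^ suc m → 1 ≤ m
4≤2^[1+m]⇒1≤m {zero}  (s≤s (s≤s ()))
4≤2^[1+m]⇒1≤m {suc m} _ = s≤s z≤n

open import Data.Nat using (_^_; _+_)

theorem13 : (r : ℕ) (F : FiniteField r) →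
    ((n : ℕ) → Σ ℕ (λ k → n ≡ suc (k + k)) → ((3 ≤ n) ⊎ ((n ≡ 1) × (8 ≤ 2 ^ r))) →
    (N : ℕ) (E : Enumeration F (InDC F n (n ∸ 1)) N) → IsF2Iso F E)
    ×
    ((n : ℕ) → Σ ℕ (λ k → n ≡ k + k) → ((4 ≤ n) ⊎ ((n ≡ 2) × (4 ≤ 2 ^ r))) →
    (N : ℕ) (E : Enumeration F (InDC F n (n ∸ 2)) N) → IsF2Iso F E)
theorem13 zero    F = ⊥-elim (order-1-absurd F)
theorem13 (suc m) F = odd , even
  where
  open DoubleCosetCodes F

  odd : (n : ℕ) → Σ ℕ (λ k → n ≡ suc (k + k)) → ((3 ≤ n) ⊎ ((n ≡ 1) × (8 ≤ 2 ^ suc m))) →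
        (N : ℕ) (E : Enumeration F (InDC F n (n ∸ 1)) N) → IsF2Iso F E
  -- For n ≥ 3 the index s = n - 1 is positive; n = 1 is the case s = 0.
  odd (suc n) _ (inj₁ (s≤s 2≤n))       N E = DCₛ-iso (ℕₚ.<-≤-trans (s≤s z≤n) 2≤n) E
  odd _       _ (inj₂ (≡.refl , 8≤q)) N E = DC₁₀-iso (8≤2^[1+m]⇒2≤m 8≤q) E

  even : (n : ℕ) → Σ ℕ (λ k → n ≡ k + k) → ((4 ≤ n) ⊎ ((n ≡ 2) × (4 ≤ 2 ^ suc m))) →
         (N : ℕ) (E : Enumeration F (InDC F n (n ∸ 2)) N) → IsF2Iso F E
  even (suc (suc n)) _ (inj₁ (s≤s (s≤s 2≤n))) N E = DCₛ-iso (ℕₚ.<-≤-trans (s≤s z≤n) 2≤n) E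
  even (suc zero)    _ (inj₁ (s≤s ()))
  even _             _ (inj₂ (≡.refl , 4≤q))  N E = DC₂₀-iso (4≤2^[1+m]⇒1≤m 4≤q) E
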